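{- Let $n\geq 40$ be an integer. Then $$ex_{ori}(n,\overrightarrow{S_{3,1}})=\left\lfloor\frac{(n+2)^2}{4}\right\rfloor.$$ Moreover, an oriented graph $D$ of order $n$ is $\overrightarrow{S_{3,1}}$-free with exactly $ex_{ori}(n,\overrightarrow{S_{3,1}})$ arcs if and only if $V(D)$ has a partition $V(D)=X\cup Y$ such that (i) $|X|\in\{\lfloor n/2\rfloor-1,\lceil n/2\rceil-1\}$; (ii) $xy\in A(D)$ for all $x\in X$, $y\in Y$; (iii) $D[X]$ has no arcs, and $D[Y]$ is an in-degree $2$-regular digraph (every vertex of $D[Y]$ has in-degree exactly $2$ in $D[Y]$).
   Context: An oriented graph is a digraph obtained from a finite simple undirected graph by choosing an orientation for each edge (so no loops, and at most one arc between any two vertices). For a digraph $F$, $D$ is $F$-free if it contains no subgraph isomorphic to $F$. The oriented Turán number $ex_{ori}(n,F)$ is the maximum number of arcs in an $F$-free oriented graph on $n$ vertices. For a positive integer $k$, $\overrightarrow{S_{k,1}}$ is the $1$-subdivision of the in-star with $k$ leaves: it has vertices $v$ (the center), $w_1,\dots,w_k$, $z_1,\dots,z_k$, and arcs $z_iw_i$ and $w_iv$ for $i=1,\dots,k$. $D[X]$ denotes the subdigraph induced by $X$. -}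

module Defs where

open import Data.Nat using (ℕ; zero; suc; _+_; _*_; _∸_; _≤_; _/_; ⌊_/2⌋; ⌈_/2⌉)
open import Data.Bool using (Bool; true; false; if_then_else_; _∧_; not)
open import Data.Fin using (Fin; zero; suc; _↑ˡ_; _↑ʳ_)
open import Data.List using (List; []; _∷_; concatMap; allFin)
open import Data.List.Relation.Unary.All using (All)
open import Data.Product using (Σ; _×_; _,_; ∃)
open import Function.Definitions using (Injective)
open import Relation.Binary.PropositionalEquality using (_≡_)

Digraph : ℕ → Set
Digraph n = Fin n → Fin n → Bool

IsOriented : {n : ℕ} → Digraph n → Set
IsOriented {n} A = ((i : Fin n) → A i i ≡ false)
                 × ((i j : Fin n) → A i j ≡ true → A j i ≡ false)

count : {n : ℕ} → (Fin n → Bool) → ℕ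
count {zero}  P = 0
count {suc n} P = (if P zero then 1 else 0) + count (λ i → P (suc i))

sumFin : {n : ℕ} → (Fin n → ℕ) → ℕ
sumFin {zero}  f = 0
sumFin {suc n} f = f zero + sumFin (λ i → f (suc i))

arcs : {n : ℕ} → Digraph n → ℕ
arcs A = sumFin (λ i → count (A i))

record Pattern : Set where
  field
    order   : ℕ
    arcList : List (Fin order × Fin order)
open Pattern public

Contains : {n : ℕ} → Digraph n → Pattern → Set
Contains {n} A F = Σ (Fin (order F) → Fin n) λ f →
  Injective _≡_ _≡_ f × All (λ { (a , b) → A (f a) (f b) ≡ true }) (arcList F)

Free : {n : ℕ} → Digraph n → Pattern → Set
Free A F = Contains A F → Data.Empty.⊥
  where import Data.Empty

IsExOri : ℕ → Pattern → ℕ → Set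
IsExOri n F m =
    ((A : Digraph n) → IsOriented A → Free A F → arcs A ≤ m)
  × Σ (Digraph n) (λ A → IsOriented A × Free A F × arcs A ≡ m)

-- The 1-subdivision of the in-star with k leaves, on Fin (1 + (k + k)):
-- center v = zero, w_i = suc (i ↑ˡ k), z_i = suc (k ↑ʳ i);
-- arcs z_i w_i and w_i v.
S⃗ : ℕ → Pattern
S⃗ k = record
  { order   = suc (k + k)
  ; arcList = concatMap (λ i → (z i , w i) ∷ (w i , v) ∷ []) (allFin k) }
  where
    v : Fin (suc (k + k))
    v = zero
    w : Fin k → Fin (suc (k + k))
    w i = suc (i ↑ˡ k)
    z : Fin k → Fin (suc (k + k))
    z i = suc (k ↑ʳ i)

inDegIn : {n : ℕ} → Digraph n → (Fin n → Bool) → Fin n → ℕ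
inDegIn A Y y = count (λ x → Y x ∧ A x y)

ExtremalPartition : {n : ℕ} → Digraph n → (Fin n → Bool) → Set
ExtremalPartition {n} A X =
    ((count X ≡ ⌊ n /2⌋ ∸ 1) Data.Sum.⊎ (count X ≡ ⌈ n /2⌉ ∸ 1))
  × ((x y : Fin n) → X x ≡ true → X y ≡ false → A x y ≡ true)
  × ((x y : Fin n) → X x ≡ true → X y ≡ true → A x y ≡ false)
  × ((y : Fin n) → X y ≡ false → inDegIn A (λ u → not (X u)) y ≡ 2)
  where import Data.Sum

{-# OPTIONS --safe #-}
module Submission where

-- D is free iff no vertex v has three disjoint arcs z → w with w in its in-neighbourhood N.  A vertex that is
-- an end of at least five arcs into N ("high") can always be completed greedily, so at most two vertices are
-- high at v, and if there are two then they cover all arcs into N.  In particular every vertex has at most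
-- two in-neighbours that are big, i.e. of in-degree at least 5.
--
-- Let v have maximum in-degree k and let E be the number of arcs into N, so that D has at most k(n - k) + E
-- arcs.  If D has at least ⌊(n+2)²/4⌋ arcs then E ≥ 2k and E > n, up to the loss L coming from vertices
-- outside N of in-degree less than k.  With fewer than two high vertices E is too small.  With two high
-- vertices p and q, counting the arcs at p and q shows L ≤ 2, so all vertices outside N are big; then p and q
-- lie in N, they are big themselves, E ≤ 2k, and all estimates are tight.  Tightness says that X = N ∖ {p , q}
-- gives the required partition.

open import Defs
open import Data.Nat using (ℕ; zero; suc; _+_; _*_; _∸_; _/_; _≤_; _<_; _≥_; z≤n; s≤s; _≤ᵇ_; _<ᵇ_; _≤?_; ⌊_/2⌋; ⌈_/2⌉)
open import Data.Nat.DivMod using (m*n/n≡m; /-monoˡ-≤; m<n*o⇒m/o<n)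
open import Data.Nat.ListAction using (sum)
open import Data.Nat.Properties hiding (_≟_)
open import Data.Nat.Tactic.RingSolver using (solve-∀)
open import Data.Bool using (Bool; true; false; if_then_else_; _∧_; _∨_; not; T)
import Data.Bool.Properties as Bool
open import Data.Empty using (⊥; ⊥-elim)
open import Data.Fin using (Fin; zero; suc; toℕ; _≟_)
open import Data.Fin.Patterns
open import Data.Fin.Properties using (any?; all?)
open import Data.List using (List; []; _∷_; _++_; map; length)
open import Data.List.Relation.Unary.All using (All; []; _∷_)
open import Data.Product using (Σ; ∃; _×_; _,_; proj₁; proj₂)
open import Data.Sum using (_⊎_; inj₁; inj₂; [_,_]′)
open import Data.Unit using (tt)
open import Data.Vec using (Vec; []; _∷_; lookup)
open import Data.Vec.Relation.Unary.All using ([]; _∷_)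
open import Data.Vec.Relation.Unary.AllPairs using ([]; _∷_)
open import Data.Vec.Relation.Unary.Unique.Propositional using (Unique)
open import Data.Vec.Relation.Unary.Unique.Propositional.Properties using (lookup-injective)
open import Function using (_∘_)
open import Function.Bundles using (_⇔_; mk⇔)
open import Relation.Binary.PropositionalEquality
open import Relation.Nullary using (¬_; Dec; yes; no; does)
open import Relation.Nullary.Decidable using (_×-dec_; _⊎-dec_; ¬?; from-yes)

private variable
  n : ℕ

-- Finite sums and cardinalities

⟦_⟧ : Bool → ℕ
⟦ b ⟧ = if b then 1 else 0

infix 7 _==_
_==_ : Fin n → Fin n → Bool
i == j = does (i ≟ j)

sum-mono : {f g : Fin n → ℕ} → (∀ i → f i ≤ g i) → sumFin f ≤ sumFin g
sum-mono {zero}  f≤g = z≤n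
sum-mono {suc n} f≤g = +-mono-≤ (f≤g zero) (sum-mono (f≤g ∘ suc))

sum-cong : {f g : Fin n → ℕ} → (∀ i → f i ≡ g i) → sumFin f ≡ sumFin g
sum-cong {zero}  f≡g = refl
sum-cong {suc n} f≡g = cong₂ _+_ (f≡g zero) (sum-cong (f≡g ∘ suc))

sum-+ : (f g : Fin n → ℕ) → sumFin (λ i → f i + g i) ≡ sumFin f + sumFin g
sum-+ {zero}  f g = refl
sum-+ {suc n} f g = trans (cong (f zero + g zero +_) (sum-+ (f ∘ suc) (g ∘ suc)))
                          (interchange (f zero) (g zero) _ _)
  where
  interchange : ∀ a b c d → a + b + (c + d) ≡ a + c + (b + d)
  interchange = solve-∀

sum-const : ∀ n c → sumFin {n} (λ _ → c) ≡ n * c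
sum-const zero    c = refl
sum-const (suc n) c = cong (c +_) (sum-const n c)

sum-zero : {f : Fin n → ℕ} → (∀ i → f i ≡ 0) → sumFin f ≡ 0
sum-zero {n} f≡0 = trans (sum-cong f≡0) (trans (sum-const n 0) (*-zeroʳ n))

sum-*ˡ : ∀ c (f : Fin n → ℕ) → sumFin (λ i → c * f i) ≡ c * sumFin f
sum-*ˡ {zero}  c f = sym (*-zeroʳ c)
sum-*ˡ {suc n} c f = trans (cong (c * f zero +_) (sum-*ˡ c (f ∘ suc)))
                           (sym (*-distribˡ-+ c (f zero) _))

sum-swap : ∀ {m n} (f : Fin m → Fin n → ℕ) →
           sumFin (λ i → sumFin (f i)) ≡ sumFin (λ j → sumFin (λ i → f i j))
sum-swap {zero}  {n} f = sym (sum-zero {n} λ _ → refl)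
sum-swap {suc m} {n} f = trans (cong (sumFin (f zero) +_) (sum-swap (f ∘ suc)))
                               (sym (sum-+ (f zero) _))

term≤sum : (f : Fin n → ℕ) (i : Fin n) → f i ≤ sumFin f
term≤sum f zero    = m≤m+n _ _
term≤sum f (suc i) = ≤-trans (term≤sum (f ∘ suc) i) (m≤n+m _ _)

sum-single : (f : Fin n → ℕ) (u : Fin n) → sumFin (λ i → if i == u then f i else 0) ≡ f u
sum-single {suc n} f zero    = trans (cong (f zero +_) (sum-zero {n} λ _ → refl)) (+-identityʳ _)
sum-single         f (suc u) = sum-single (f ∘ suc) u

count-sum : (P : Fin n → Bool) → count P ≡ sumFin (λ i → ⟦ P i ⟧)
count-sum {zero}  P = refl
count-sum {suc n} P = cong (⟦ P zero ⟧ +_) (count-sum (P ∘ suc))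

count-single : (u : Fin n) → count (_== u) ≡ 1
count-single u = trans (count-sum (_== u)) (sum-single (λ _ → 1) u)

count-cong : {P Q : Fin n → Bool} → (∀ i → P i ≡ Q i) → count P ≡ count Q
count-cong {zero}  P≡Q = refl
count-cong {suc n} P≡Q = cong₂ (λ b c → ⟦ b ⟧ + c) (P≡Q zero) (count-cong (P≡Q ∘ suc))

count-false : {P : Fin n → Bool} → (∀ i → P i ≡ false) → count P ≡ 0
count-false {zero}  P≡f = refl
count-false {suc n} P≡f = cong₂ (λ b c → ⟦ b ⟧ + c) (P≡f zero) (count-false (P≡f ∘ suc))

-- Unlike sumFin, leaves no trailing "+ 0".
sum⁺ : ∀ m → (Fin m → ℕ) → ℕ
sum⁺ 0             f = 0
sum⁺ 1             f = f zero
sum⁺ (suc (suc m)) f = f zero + sum⁺ (suc m) (f ∘ suc)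

sum⁺-swap : ∀ m (f : Fin n → Fin m → ℕ) →
            sumFin (λ i → sum⁺ m (f i)) ≡ sum⁺ m (λ j → sumFin (λ i → f i j))
sum⁺-swap {n} 0             f = sum-zero {n} λ _ → refl
sum⁺-swap     1             f = refl
sum⁺-swap     (suc (suc m)) f = trans (sum-+ (λ i → f i zero) _)
                                      (cong (sumFin (λ i → f i zero) +_) (sum⁺-swap (suc m) (λ i → f i ∘ suc)))

sum⁺-cong : ∀ m {f g : Fin m → ℕ} → (∀ j → f j ≡ g j) → sum⁺ m f ≡ sum⁺ m g
sum⁺-cong 0             f≡g = refl
sum⁺-cong 1             f≡g = f≡g zero
sum⁺-cong (suc (suc m)) f≡g = cong₂ _+_ (f≡g zero) (sum⁺-cong (suc m) (f≡g ∘ suc))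

-- Truth tables for inequalities between cardinalities

infixr 3 _⇒_
_⇒_ : Bool → Bool → Bool
a ⇒ b = not a ∨ b

infixr 5 _&_
_&_ : {a b : Bool} → a ≡ true → b ≡ true → a ∧ b ≡ true
refl & refl = refl

∧-true : (a : Bool) {b : Bool} → a ∧ b ≡ true → a ≡ true × b ≡ true
∧-true true eq = refl , eq

⇒-elim : (a : Bool) {b : Bool} → (a ⇒ b) ≡ true → a ≡ true → b ≡ true
⇒-elim true eq _ = eq

iff : Bool → Bool → Bool
iff a b = (a ⇒ b) ∧ (b ⇒ a)

≡⇒iff : ∀ {a b} → a ≡ b → iff a b ≡ true
≡⇒iff {true}  refl = refl
≡⇒iff {false} refl = refl

not-true : {a : Bool} → a ≡ false → not a ≡ true
not-true refl = refl

true≢false : {a : Bool} → a ≡ true → a ≡ false → ⊥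
true≢false refl ()

valid : ∀ k → (Vec Bool k → Bool) → Bool
valid zero    φ = φ []
valid (suc k) φ = valid k (φ ∘ (true ∷_)) ∧ valid k (φ ∘ (false ∷_))

valid-sound : ∀ k φ → T (valid k φ) → ∀ xs → φ xs ≡ true
valid-sound zero    φ t [] with φ []
... | true = refl
valid-sound (suc k) φ t (x ∷ xs) with valid k (φ ∘ (true ∷_)) in eq₁ | valid k (φ ∘ (false ∷_)) in eq₂
valid-sound (suc k) φ t (true  ∷ xs) | true | true = valid-sound k _ (subst T (sym eq₁) tt) xs
valid-sound (suc k) φ t (false ∷ xs) | true | true = valid-sound k _ (subst T (sym eq₂) tt) xs

weight : ∀ {m} → Vec Bool m → ℕ
weight {m} bs = sum⁺ m (λ j → ⟦ lookup bs j ⟧)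

-- An inequality between sums of cardinalities of sets, each a Boolean combination of the atoms xs,
-- follows from its pointwise version, and that is decided by the truth table.  The three components
-- of φ are the hypothesis on the atoms, the sets on the left and the sets on the right.
count-≤ : ∀ k {l r} (φ : Vec Bool k → Bool × Vec Bool l × Vec Bool r) →
          T (valid k (λ xs → proj₁ (φ xs) ⇒ weight (proj₁ (proj₂ (φ xs))) ≤ᵇ weight (proj₂ (proj₂ (φ xs))))) →
          (xs : Fin n → Vec Bool k) → (∀ i → proj₁ (φ (xs i)) ≡ true) →
          sum⁺ l (λ j → count (λ i → lookup (proj₁ (proj₂ (φ (xs i)))) j)) ≤
          sum⁺ r (λ j → count (λ i → lookup (proj₂ (proj₂ (φ (xs i)))) j))
count-≤ {n} k φ t xs h =
  subst₂ _≤_ (total (λ i → proj₁ (proj₂ (φ (xs i))))) (total (λ i → proj₂ (proj₂ (φ (xs i)))))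
    (sum-mono pointwise)
  where
  total : ∀ {m} (f : Fin n → Vec Bool m) →
          sumFin (λ i → weight (f i)) ≡ sum⁺ m (λ j → count (λ i → lookup (f i) j))
  total {m} f = trans (sum⁺-swap m (λ i j → ⟦ lookup (f i) j ⟧))
                      (sum⁺-cong m λ j → sym (count-sum (λ i → lookup (f i) j)))
  pointwise : ∀ i → weight (proj₁ (proj₂ (φ (xs i)))) ≤ weight (proj₂ (proj₂ (φ (xs i))))
  pointwise i = ≤ᵇ⇒≤ _ _ (subst T (sym (⇒-elim (proj₁ (φ (xs i))) (valid-sound k _ t (xs i)) (h i))) tt)

count-mono : {P Q : Fin n → Bool} → (∀ i → (P i ⇒ Q i) ≡ true) → count P ≤ count Q
count-mono {P = P} {Q} =
  count-≤ 2 (λ { (p ∷ q ∷ []) → (p ⇒ q) , p ∷ [] , q ∷ [] }) tt (λ i → P i ∷ Q i ∷ [])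

==-elim : (P : Fin n → Bool) (u : Fin n) → P u ≡ true → ∀ i → (i == u ⇒ P i) ≡ true
==-elim P u Pu i with i ≟ u
... | yes refl = Pu
... | no  _    = refl

-- An element of `P` outside `Q` would be a singleton disjoint from `P ∧ Q` inside `P`, one element
-- too many.
count-full : (P Q : Fin n → Bool) → count P ≤ count (λ i → P i ∧ Q i) →
             ∀ i → P i ≡ true → Q i ≡ true
count-full P Q le i Pi with Q i in Qi
... | true  = refl
... | false = ⊥-elim (1+n≰n (≤-trans (subst (λ c → c + count (λ j → P j ∧ Q j) ≤ count P) (count-single i) bound) le))
  where
  bound : count (_== i) + count (λ j → P j ∧ Q j) ≤ count P
  bound = count-≤ 3 (λ { (e ∷ p ∷ q ∷ []) → (e ⇒ p ∧ not q) , (e ∷ p ∧ q ∷ []) , p ∷ [] })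
            tt (λ j → j == i ∷ P j ∷ Q j ∷ []) (==-elim (λ j → P j ∧ not (Q j)) i (Pi & not-true Qi))

count-positive : (P : Fin n → Bool) → 1 ≤ count P → ∃ λ i → P i ≡ true
count-positive {suc n} P le with P zero in eq
... | true  = zero , eq
... | false with count-positive (P ∘ suc) le
...   | i , Pi = suc i , Pi

count-at : (P : Fin n → Bool) (u : Fin n) → count (λ i → i == u ∧ P i) ≡ ⟦ P u ⟧
count-at P u = trans (count-sum (λ i → i == u ∧ P i))
                     (trans (sum-cong λ i → indicator (i == u) (P i)) (sum-single (λ i → ⟦ P i ⟧) u))
  where
  indicator : ∀ e p → ⟦ e ∧ p ⟧ ≡ (if e then ⟦ p ⟧ else 0)
  indicator true  p = refl
  indicator false p = refl

count-remove : (P : Fin n → Bool) (u : Fin n) →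
               count P ≤ count (λ i → P i ∧ not (i == u)) + ⟦ P u ⟧
count-remove P u = subst (λ c → count P ≤ count (λ i → P i ∧ not (i == u)) + c) (count-at P u)
  (count-≤ 2 (λ { (p ∷ e ∷ []) → true , p ∷ [] , p ∧ not e ∷ e ∧ p ∷ [] })
     tt (λ i → P i ∷ i == u ∷ []) (λ _ → refl))

⟦⟧≤1 : ∀ b → ⟦ b ⟧ ≤ 1
⟦⟧≤1 true  = ≤-refl
⟦⟧≤1 false = z≤n

count-remove≤ : (P : Fin n → Bool) (u : Fin n) → count P ≤ suc (count (λ i → P i ∧ not (i == u)))
count-remove≤ P u = ≤-trans (count-remove P u)
  (≤-trans (+-monoʳ-≤ _ (⟦⟧≤1 (P u))) (≤-reflexive (+-comm _ 1)))

not-==⇒≢ : {i u : Fin n} → not (i == u) ≡ true → i ≢ u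
not-==⇒≢ {i = i} eq refl with i ≟ i
not-==⇒≢ () refl | yes _
... | no i≢i = i≢i refl

≢⇒not-== : {i u : Fin n} → i ≢ u → not (i == u) ≡ true
≢⇒not-== {i = i} {u} i≢u with i ≟ u
... | yes i≡u = ⊥-elim (i≢u i≡u)
... | no  _   = refl

pick : (P : Fin n → Bool) (F : List (Fin n)) → length F < count P →
       ∃ λ i → P i ≡ true × All (i ≢_) F
pick P []      lt with count-positive P lt
... | i , Pi = i , Pi , []
pick P (u ∷ F) lt with pick (λ i → P i ∧ not (i == u)) F (≤-pred (≤-trans lt (count-remove≤ P u)))
... | i , PQi , i∉F with ∧-true (P i) PQi
...   | Pi , i≠u = i , Pi , not-==⇒≢ i≠u ∷ i∉F

count≤n : (P : Fin n → Bool) → count P ≤ n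
count≤n {zero}  P = z≤n
count≤n {suc n} P = +-mono-≤ (⟦⟧≤1 (P zero)) (count≤n (P ∘ suc))

-- Pairs covered by few vertices

pairs : (Fin n → Fin n → Bool) → ℕ
pairs R = sumFin (λ w → count (λ z → R z w))

degree : (Fin n → Fin n → Bool) → Fin n → ℕ
degree R u = count (λ z → R z u) + count (λ w → R u w)

delete : (Fin n → Fin n → Bool) → Fin n → Fin n → Fin n → Bool
delete R u z w = R z w ∧ (not (w == u) ∧ not (z == u))

-- The column of `u` disappears and every other column loses at most its entry in row `u`. A pair
-- `(u , u)` would be counted twice, hence only an inequality.
pairs-delete : (R : Fin n → Fin n → Bool) (u : Fin n) → pairs R ≤ degree R u + pairs (delete R u)
pairs-delete R u = ≤-trans (sum-mono column) (≤-reflexive total)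
  where
  column : ∀ w → count (λ z → R z w) ≤
                 (if w == u then count (λ z → R z w) else 0) + ⟦ R u w ⟧ + count (λ z → delete R u z w)
  column w with w ≟ u
  ... | yes refl = ≤-trans (m≤m+n _ ⟦ R u u ⟧) (m≤m+n _ _)
  ... | no  _    = ≤-trans (count-remove (λ z → R z w) u) (≤-reflexive (+-comm _ ⟦ R u w ⟧))
  total : sumFin (λ w → (if w == u then count (λ z → R z w) else 0) + ⟦ R u w ⟧ + count (λ z → delete R u z w))
          ≡ degree R u + pairs (delete R u)
  total = trans (sum-+ (λ w → (if w == u then count (λ z → R z w) else 0) + ⟦ R u w ⟧) _)
                (cong (_+ pairs (delete R u))
                  (trans (sum-+ (λ w → if w == u then count (λ z → R z w) else 0) _)
                         (cong₂ _+_ (sum-single (λ w → count (λ z → R z w)) u) (sym (count-sum (R u))))))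

-- The vertices of `U` are deleted one at a time. Degrees only shrink, so if no pair survives, the
-- original degrees account for all pairs.
uncovered-pair : (R : Fin n → Fin n → Bool) (U : List (Fin n)) →
  (∃ λ z → ∃ λ w → R z w ≡ true × All (z ≢_) U × All (w ≢_) U) ⊎ pairs R ≤ sum (map (degree R) U)
uncovered-pair R [] with any? (λ z → any? (λ w → R z w Bool.≟ true))
... | yes (z , w , Rzw) = inj₁ (z , w , Rzw , [] , [])
... | no  none          = inj₂ (≤-reflexive (sum-zero λ w → count-false λ z →
                            Bool.¬-not λ Rzw → none (z , w , Rzw)))
uncovered-pair R (u ∷ U) with uncovered-pair (delete R u) U
... | inj₁ (z , w , Dzw , z∉U , w∉U) with ∧-true (R z w) Dzw
...   | Rzw , ≠u with ∧-true (not (w == u)) ≠u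
...     | w≠u , z≠u = inj₁ (z , w , Rzw , not-==⇒≢ z≠u ∷ z∉U , not-==⇒≢ w≠u ∷ w∉U)
uncovered-pair R (u ∷ U) | inj₂ le =
  inj₂ (≤-trans (pairs-delete R u) (+-monoʳ-≤ (degree R u) (≤-trans le (degrees U))))
  where
  weaken : ∀ a b → (a ∧ b ⇒ a) ≡ true
  weaken true  true  = refl
  weaken true  false = refl
  weaken false _     = refl
  degrees : ∀ V → sum (map (degree (delete R u)) V) ≤ sum (map (degree R) V)
  degrees []      = z≤n
  degrees (x ∷ V) = +-mono-≤ (+-mono-≤ (count-mono λ z → weaken (R z x) _)
                                       (count-mono λ w → weaken (R x w) _)) (degrees V)

-- Paths z → w → v

module InPaths (A : Digraph n) where

  d : Fin n → ℕ
  d u = count (λ z → A z u)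

  big : Fin n → Bool
  big u = 5 ≤ᵇ d u

  bigIn : Fin n → ℕ
  bigIn v = count (λ w → A w v ∧ big w)

  through from : Fin n → Fin n → ℕ
  through v u = count (λ z → A z u ∧ A u v)
  from    v u = count (λ w → A u w ∧ A w v)

  -- Five arcs of one kind are required, so that `u` can be kept as midpoint or as tail while the
  -- other end dodges four prescribed vertices.
  High : Fin n → Fin n → Set
  High v u = 5 ≤ through v u ⊎ 5 ≤ from v u

  high? : ∀ v u → Dec (High v u)
  high? v u = (5 ≤? through v u) ⊎-dec (5 ≤? from v u)

  record Path (v : Fin n) : Set where
    constructor path
    field
      {tail mid} : Fin n
      tail→mid   : A tail mid ≡ true
      mid→end    : A mid v ≡ true

  verts : ∀ {v} → Path v → List (Fin n)
  verts e = Path.tail e ∷ Path.mid e ∷ []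

  Avoids : ∀ {v} → Path v → List (Fin n) → Set
  Avoids e F = All (Path.tail e ≢_) F × All (Path.mid e ≢_) F

  high-path : ∀ {v p} → High v p → (F : List (Fin n)) → length F < 5 → All (p ≢_) F →
              ∃ λ (e : Path v) → Avoids e F
  high-path {v} {p} (inj₁ hi) F F<5 p∉F with pick (λ z → A z p ∧ A p v) F (≤-trans F<5 hi)
  ... | z , arcs , z∉F with ∧-true (A z p) arcs
  ...   | zp , pv = path zp pv , z∉F , p∉F
  high-path {v} {p} (inj₂ hi) F F<5 p∉F with pick (λ w → A p w ∧ A w v) F (≤-trans F<5 hi)
  ... | w , arcs , w∉F with ∧-true (A p w) arcs
  ...   | pw , wv = path pw wv , p∉F , w∉F

  -- Once `w → v` is an arc, every in-neighbour of `w` starts a path through `w` to `v`.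
  big⇒high : ∀ {v w} → A w v ∧ big w ≡ true → High v w
  big⇒high {v} {w} eq with ∧-true (A w v) eq
  ... | wv , bigw = inj₁ (≤-trans (≤ᵇ⇒≤ 5 (d w) (subst T (sym bigw) tt))
                                  (count-mono λ z → wv⇒ (A z w)))
    where
    wv⇒ : ∀ a → (a ⇒ a ∧ A w v) ≡ true
    wv⇒ true  = wv
    wv⇒ false = refl

  module Oriented (ori : IsOriented A) where

    arc⇒≢ : ∀ {i j} → A i j ≡ true → i ≢ j
    arc⇒≢ {i} ij refl = true≢false ij (proj₁ ori i)

    antisym : ∀ i j → not (A i j ∧ A j i) ≡ true
    antisym i j with A i j in ij
    ... | true  = not-true (proj₂ ori i j ij)
    ... | false = refl

    module NoS31 (free : Free A (S⃗ 3)) where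

      no-3-paths : ∀ {v} (e₁ e₂ e₃ : Path v) → Avoids e₂ (verts e₁) →
                   Avoids e₃ (verts e₂ ++ verts e₁) → ⊥
      no-3-paths {v} (path {z₁} {w₁} z₁w₁ w₁v) (path {z₂} {w₂} z₂w₂ w₂v) (path {z₃} {w₃} z₃w₃ w₃v)
        (z₂z₁ ∷ z₂w₁ ∷ [] , w₂z₁ ∷ w₂w₁ ∷ [])
        (z₃z₂ ∷ z₃w₂ ∷ z₃z₁ ∷ z₃w₁ ∷ [] , w₃z₂ ∷ w₃w₂ ∷ w₃z₁ ∷ w₃w₁ ∷ []) =
        free (lookup f , (λ {i} {j} → lookup-injective unique i j) ,
              z₁w₁ ∷ w₁v ∷ z₂w₂ ∷ w₂v ∷ z₃w₃ ∷ w₃v ∷ [])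
        where
        f : Vec (Fin n) 7
        f = v ∷ w₁ ∷ w₂ ∷ w₃ ∷ z₁ ∷ z₂ ∷ z₃ ∷ []
        v≢mid : ∀ {w} → A w v ≡ true → v ≢ w
        v≢mid wv refl = arc⇒≢ wv refl
        v≢tail : ∀ {z w} → A z w ≡ true → A w v ≡ true → v ≢ z
        v≢tail {z} {w} zw wv refl = true≢false wv (proj₂ ori z w zw)
        unique : Unique f
        unique =
            (v≢mid w₁v ∷ v≢mid w₂v ∷ v≢mid w₃v ∷
              v≢tail z₁w₁ w₁v ∷ v≢tail z₂w₂ w₂v ∷ v≢tail z₃w₃ w₃v ∷ [])
          ∷ ((w₂w₁ ∘ sym) ∷ (w₃w₁ ∘ sym) ∷ (arc⇒≢ z₁w₁ ∘ sym) ∷ (z₂w₁ ∘ sym) ∷ (z₃w₁ ∘ sym) ∷ [])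
          ∷ ((w₃w₂ ∘ sym) ∷ w₂z₁ ∷ (arc⇒≢ z₂w₂ ∘ sym) ∷ (z₃w₂ ∘ sym) ∷ [])
          ∷ (w₃z₁ ∷ w₃z₂ ∷ (arc⇒≢ z₃w₃ ∘ sym) ∷ [])
          ∷ ((z₂z₁ ∘ sym) ∷ (z₃z₁ ∘ sym) ∷ [])
          ∷ ((z₃z₂ ∘ sym) ∷ [])
          ∷ []
          ∷ []

      -- A high vertex has so many paths that one of them avoids the at most four
      -- vertices claimed by the other two members of a would-be triple.
      no-2-paths-1-high : ∀ {v p} (e₁ e₂ : Path v) → Avoids e₂ (verts e₁) → High v p →
                          Avoids e₁ (p ∷ []) → Avoids e₂ (p ∷ []) → ⊥
      no-2-paths-1-high {v} e₁ e₂ e₂∉ hp (z₁p ∷ [] , w₁p ∷ []) (z₂p ∷ [] , w₂p ∷ [])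
        with high-path hp (verts e₂ ++ verts e₁) (s≤s ≤-refl)
               ((z₂p ∘ sym) ∷ (w₂p ∘ sym) ∷ (z₁p ∘ sym) ∷ (w₁p ∘ sym) ∷ [])
      ... | e₃ , e₃∉ = no-3-paths e₁ e₂ e₃ e₂∉ e₃∉

      no-1-path-2-high : ∀ {v p q} (e : Path v) → High v p → High v q → p ≢ q →
                         Avoids e (p ∷ q ∷ []) → ⊥
      no-1-path-2-high {q = q} e hp hq p≢q (zp ∷ zq ∷ [] , wp ∷ wq ∷ [])
        with high-path hp (q ∷ verts e) (s≤s (s≤s (s≤s (s≤s z≤n)))) (p≢q ∷ (zp ∘ sym) ∷ (wp ∘ sym) ∷ [])
      ... | e₂ , (z₂q ∷ z₂∉) , (w₂q ∷ w₂∉) =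
        no-2-paths-1-high e e₂ (z₂∉ , w₂∉) hq (zq ∷ [] , wq ∷ []) (z₂q ∷ [] , w₂q ∷ [])

      no-3-high : ∀ {v p q r} → High v p → High v q → High v r → p ≢ q → p ≢ r → q ≢ r → ⊥
      no-3-high {q = q} {r} hp hq hr p≢q p≢r q≢r
        with high-path hp (q ∷ r ∷ []) (s≤s (s≤s (s≤s z≤n))) (p≢q ∷ p≢r ∷ [])
      ... | e , e∉ = no-1-path-2-high e hq hr q≢r e∉

      bigIn≤2 : ∀ v → bigIn v ≤ 2
      bigIn≤2 v = ≮⇒≥ three
        where
        bw : Fin n → Bool
        bw w = A w v ∧ big w
        three : 2 < bigIn v → ⊥
        three 2<b with pick bw [] (≤-trans (s≤s z≤n) 2<b)
        ... | p , bp , _ with pick bw (p ∷ []) (≤-trans (s≤s (s≤s z≤n)) 2<b)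
        ...   | q , bq , q≢p ∷ [] with pick bw (p ∷ q ∷ []) 2<b
        ...     | r , br , r≢p ∷ r≢q ∷ [] =
          no-3-high (big⇒high bp) (big⇒high bq) (big⇒high br) (q≢p ∘ sym) (r≢p ∘ sym) (r≢q ∘ sym)

      small≢ : ∀ {v w p} → A w v ∧ big w ≡ true → big p ≡ false → w ≢ p
      small≢ {v} {w} bw sp refl = true≢false (proj₂ (∧-true (A w v) bw)) sp

      -- Big in-neighbours are high and differ from the small `p`, so `p` uses up one of the two
      -- places for high vertices.
      bigIn≤1 : ∀ {v p} → High v p → big p ≡ false → bigIn v ≤ 1
      bigIn≤1 {v} {p} hp sp = ≮⇒≥ two
        where
        two : 1 < bigIn v → ⊥
        two 1<b with pick (λ w → A w v ∧ big w) [] (≤-trans (s≤s z≤n) 1<b)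
        ... | q , bq , _ with pick (λ w → A w v ∧ big w) (q ∷ []) 1<b
        ...   | r , br , r≢q ∷ [] =
          no-3-high (big⇒high bq) (big⇒high br) hp (r≢q ∘ sym) (small≢ bq sp) (small≢ br sp)

      bigIn≤0 : ∀ {v p q} → High v p → big p ≡ false → High v q → big q ≡ false → p ≢ q → bigIn v ≤ 0
      bigIn≤0 {v} {p} hp sp hq sq p≢q = ≮⇒≥ λ 0<b → let
        r , br , _ = pick (λ w → A w v ∧ big w) [] 0<b
        in no-3-high (big⇒high br) hp hq (small≢ br sp) (small≢ br sq) p≢q

-- Arithmetic

-- A certificate for linear arithmetic: the hypotheses are added up to `a ≤ b`, the ring solver
-- exposes the common part `c` to be cancelled, and `r` is slack to be dropped.
lin-≤ : ∀ c r {a b x y} → a ≤ b → a ≡ c + (r + x) → b ≡ c + y → x ≤ y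
lin-≤ c r a≤b refl refl = m+n≤o⇒n≤o r (+-cancelˡ-≤ c _ _ a≤b)

lin-⊥ : ∀ r {a b} → a ≤ b → a ≡ suc (b + r) → ⊥
lin-⊥ r a≤b refl = m+n≮m _ r a≤b

quarter-≤ : ∀ {x y} → x * 4 ≤ y → x ≤ y / 4
quarter-≤ {x} le = subst (_≤ _) (m*n/n≡m x 4) (/-monoˡ-≤ 4 le)

am-gm : ∀ a b → a * b ≤ ((a + b) * (a + b)) / 4
am-gm a b = quarter-≤ ([ ordered a b , swapped ]′ (≤-total a b))
  where
  square : ∀ a c → (a + (a + c)) * (a + (a + c)) ≡ a * (a + c) * 4 + c * c
  square = solve-∀
  ordered : ∀ a b → a ≤ b → a * b * 4 ≤ (a + b) * (a + b)
  ordered a b a≤b with m≤n⇒∃[o]m+o≡n a≤b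
  ... | c , refl = ≤-trans (m≤m+n _ _) (≤-reflexive (sym (square a c)))
  swapped : b ≤ a → a * b * 4 ≤ (a + b) * (a + b)
  swapped b≤a rewrite *-comm a b | +-comm a b = ordered b a b≤a

-- `S` stands for the number of arcs, `M` for the claimed maximum and `j` for `n - k`, so the
-- equation says `E = S + L - k * j`. The gain `2k` is `k * (j + 2) - k * j`; in `excess>n` it is
-- `suc k * suc j - k * j`, which is `n + 1`.
excess≥2k : ∀ k j L {S E M} → M ≤ S → S + L + k * k ≡ E + (k + j) * k →
            k * (j + 2) ≤ M → k * 2 + L ≤ E
excess≥2k k j L {E = E} M≤S eq le =
  lin-≤ (k * j + k * k) 0 (≤-trans (+-monoˡ-≤ (k * k) (+-monoˡ-≤ L (≤-trans le M≤S))) (≤-reflexive eq))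
    (lhs k j L) (rhs k j E)
  where
  lhs : ∀ k j L → k * (j + 2) + L + k * k ≡ k * j + k * k + (0 + (k * 2 + L))
  lhs = solve-∀
  rhs : ∀ k j E → E + (k + j) * k ≡ k * j + k * k + E
  rhs = solve-∀

excess>n : ∀ k j L {S E M} → M ≤ S → S + L + k * k ≡ E + (k + j) * k →
           suc k * suc j ≤ M → suc (k + j) + L ≤ E
excess>n k j L {E = E} M≤S eq le =
  lin-≤ (k * j + k * k) 0 (≤-trans (+-monoˡ-≤ (k * k) (+-monoˡ-≤ L (≤-trans le M≤S))) (≤-reflexive eq))
    (lhs k j L) (rhs k j E)
  where
  lhs : ∀ k j L → suc k * suc j + L + k * k ≡ k * j + k * k + (0 + (suc (k + j) + L))
  lhs = solve-∀
  rhs : ∀ k j E → E + (k + j) * k ≡ k * j + k * k + E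
  rhs = solve-∀

many-arcs⇒k≥9 : ∀ {n k S} → 40 ≤ n → ((n + 2) * (n + 2)) / 4 ≤ S → S ≤ n * k → 9 ≤ k
many-arcs⇒k≥9 {n} {k} n≥40 M≤S S≤nk = ≰⇒> small-k
  where
  -- In-degrees of at most 8 allow only `8n` arcs, whereas `(n + 2)² ≥ 42 (n + 2) ≥ 4 (8n + 1)`.
  expand : ∀ n → suc (n * 8) * 4 + (80 + n * 10) ≡ 42 * (n + 2)
  expand = solve-∀
  large : suc (n * 8) ≤ ((n + 2) * (n + 2)) / 4
  large = quarter-≤ (≤-trans (m≤m+n _ (80 + n * 10))
            (≤-trans (≤-reflexive (expand n)) (*-monoˡ-≤ (n + 2) (+-monoˡ-≤ 2 n≥40))))
  small-k : k ≤ 8 → ⊥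
  small-k k≤8 = 1+n≰n (≤-trans large (≤-trans M≤S (≤-trans S≤nk (*-monoʳ-≤ n k≤8))))

-- The two lower bounds add up to `2E ≥ 2k + 41 + 2L`, the upper bounds give `2E ≤ 2k + 34 + 2σ`,
-- and `5σ ≤ L`.
one-high-⊥ : ∀ k L σ {E D} → k * 2 + L ≤ E → 41 + L ≤ E → E ≤ D + 16 → suc D ≤ k + (2 + σ) → σ * 5 ≤ L → ⊥
one-high-⊥ k L σ {E} {D} h₁ h₂ h₃ h₄ h₅ =
  lin-⊥ (6 + σ * 8) (+-mono-≤ (+-mono-≤ (+-mono-≤ h₁ h₂) (+-mono-≤ h₃ h₃)) (+-mono-≤ (+-mono-≤ h₄ h₄) (+-mono-≤ h₅ h₅)))
    (eq k L σ E D)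
  where
  eq : ∀ k L σ E D → k * 2 + L + (41 + L) + (E + E) + (suc D + suc D + (σ * 5 + σ * 5))
     ≡ suc (E + E + (D + 16 + (D + 16)) + (k + (2 + σ) + (k + (2 + σ)) + (L + L)) + (6 + σ * 8))
  eq = solve-∀

-- From `2k + L ≤ E ≤ D₁ + D₂ ≤ 2k + 2 + 2σ` follows `L ≤ 2 + 2σ`, and together with `5σ ≤ L` this
-- forces `σ = 0`.
two-high-loss : ∀ k L σ {E D₁ D₂} → k * 2 + L ≤ E → E ≤ D₁ + (D₂ + 0) →
                suc D₁ ≤ k + (2 + σ) → suc D₂ ≤ k + (2 + σ) → σ * 5 ≤ L → L ≤ 2
two-high-loss k L σ {E} {D₁} {D₂} h₁ h₂ h₃ h₄ h₅ with σ
... | zero  = lin-≤ (k * 2 + E + suc D₁ + suc D₂) 0 (+-mono-≤ (+-mono-≤ h₁ h₂) (+-mono-≤ h₃ h₄)) (lhs k L E D₁ D₂) (rhs k E D₁ D₂)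
  where
  lhs : ∀ k L E D₁ D₂ → k * 2 + L + E + (suc D₁ + suc D₂) ≡ k * 2 + E + suc D₁ + suc D₂ + (0 + L)
  lhs = solve-∀
  rhs : ∀ k E D₁ D₂ → E + (D₁ + (D₂ + 0)) + (k + 2 + (k + 2)) ≡ k * 2 + E + suc D₁ + suc D₂ + 2
  rhs = solve-∀
... | suc σ = ⊥-elim (lin-⊥ (σ * 3) (+-mono-≤ (+-mono-≤ (+-mono-≤ h₁ h₂) (+-mono-≤ h₃ h₄)) h₅) (eq k L σ E D₁ D₂))
  where
  eq : ∀ k L σ E D₁ D₂ → k * 2 + L + E + (suc D₁ + suc D₂) + suc σ * 5
     ≡ suc (E + (D₁ + (D₂ + 0)) + (k + (2 + suc σ) + (k + (2 + suc σ))) + L + σ * 3)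
  eq = solve-∀

two-high-k : ∀ k L σ {E D₁ D₂} → 41 + L ≤ E → E ≤ D₁ + (D₂ + 0) →
             suc D₁ ≤ k + (2 + σ) → suc D₂ ≤ k + (2 + σ) → σ * 5 ≤ L → 20 ≤ k
two-high-k k L σ {E} {D₁} {D₂} h₁ h₂ h₃ h₄ h₅ = ≰⇒> λ k≤19 →
  lin-⊥ (σ * 3) (+-mono-≤ (+-mono-≤ (+-mono-≤ h₁ h₂) (+-mono-≤ h₃ h₄)) (+-mono-≤ h₅ (+-mono-≤ k≤19 k≤19))) (eq k L σ E D₁ D₂)
  where
  eq : ∀ k L σ E D₁ D₂ → 41 + L + E + (suc D₁ + suc D₂) + (σ * 5 + (k + k))
     ≡ suc (E + (D₁ + (D₂ + 0)) + (k + (2 + σ) + (k + (2 + σ))) + (L + 38) + σ * 3)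
  eq = solve-∀

outside-⊥ : ∀ k {f du b} → 5 ≤ f → f + du ≤ k + b → k ≤ du + 2 → b ≤ 2 → ⊥
outside-⊥ k {f} {du} {b} h₁ h₂ h₃ h₄ =
  lin-⊥ 0 (+-mono-≤ (+-mono-≤ h₁ h₂) (+-mono-≤ h₃ h₄)) (eq k f du b)
  where
  eq : ∀ k f du b → 5 + (f + du) + (k + b) ≡ suc (f + (k + b) + (du + 2 + 2) + 0)
  eq = solve-∀

small⇒r⁺-large : ∀ k {r⁻ r⁺ x y ax ay i ρ E} → k * 2 ≤ E →
  E ≤ (r⁻ + r⁺) + y + (ax + ay) + i → y ≤ ρ → ρ + 2 ≤ k → ax ≤ 2 → ay ≤ 2 → i ≤ 1 → r⁻ ≤ x → x ≤ 4 → k ≤ r⁺ + 7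
small⇒r⁺-large k {r⁻} {r⁺} {x} {y} {ax} {ay} {i} {ρ} {E} h₁ h₂ h₃ h₄ h₅ h₆ h₇ h₈ h₉ =
  lin-≤ (k + E + y + ρ + 2 + ax + ay + i + r⁻ + x) 0
    (+-mono-≤ (+-mono-≤ (+-mono-≤ h₁ h₂) (+-mono-≤ h₃ h₄)) (+-mono-≤ (+-mono-≤ h₅ h₆) (+-mono-≤ h₇ (+-mono-≤ h₈ h₉))))
    (lhs k r⁻ x y ax ay i ρ E) (rhs k r⁻ r⁺ x y ax ay i ρ E)
  where
  lhs : ∀ k r⁻ x y ax ay i ρ E → k * 2 + E + (y + (ρ + 2)) + (ax + ay + (i + (r⁻ + x)))
      ≡ k + E + y + ρ + 2 + ax + ay + i + r⁻ + x + (0 + k)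
  lhs = solve-∀
  rhs : ∀ k r⁻ r⁺ x y ax ay i ρ E → E + ((r⁻ + r⁺) + y + (ax + ay) + i) + (ρ + k) + (2 + 2 + (1 + (x + 4)))
      ≡ k + E + y + ρ + 2 + ax + ay + i + r⁻ + x + (r⁺ + 7)
  rhs = solve-∀

-- Inclusion-exclusion: subsets of sizes at least `k - 7` and `k - 3` of a set of size at most
-- `k - 2` share at least `k - 8 ≥ 12` elements.
common-large : ∀ k {r⁺ t ρ f} → 20 ≤ k → k ≤ r⁺ + 7 → k ≤ t + 3 → r⁺ + t ≤ ρ + f → ρ + 2 ≤ k → 5 ≤ f
common-large k {r⁺} {t} {ρ} {f} h₁ h₂ h₃ h₄ h₅ =
  lin-≤ (k + k + r⁺ + t + ρ + 10) 7 (+-mono-≤ (+-mono-≤ (+-mono-≤ h₁ h₂) (+-mono-≤ h₃ h₄)) h₅)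
    (lhs k r⁺ t ρ) (rhs k r⁺ t ρ f)
  where
  lhs : ∀ k r⁺ t ρ → 20 + k + (k + (r⁺ + t)) + (ρ + 2) ≡ k + k + r⁺ + t + ρ + 10 + (7 + 5)
  lhs = solve-∀
  rhs : ∀ k r⁺ t ρ f → k + (r⁺ + 7) + (t + 3 + (ρ + f)) + k ≡ k + k + r⁺ + t + ρ + 10 + f
  rhs = solve-∀

small-⊥ : ∀ k L {x y ax ay i ρ E} → k * 2 + L ≤ E → E ≤ x + y + (ax + ay) + i →
  x ≤ ρ → y ≤ ρ → ρ + 2 ≤ k → ax ≤ L → ay ≤ 2 → i ≤ 1 → ⊥
small-⊥ k L {x} {y} {ax} {ay} {i} {ρ} {E} h₁ h₂ h₃ h₄ h₅ h₆ h₇ h₈ =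
  lin-⊥ 0 (+-mono-≤ (+-mono-≤ (+-mono-≤ h₁ h₂) (+-mono-≤ h₃ h₄)) (+-mono-≤ (+-mono-≤ h₅ h₅) (+-mono-≤ h₆ (+-mono-≤ h₇ h₈))))
    (eq k L x y ax ay i ρ E)
  where
  eq : ∀ k L x y ax ay i ρ E → k * 2 + L + E + (x + y) + (ρ + 2 + (ρ + 2) + (ax + (ay + i)))
     ≡ suc (E + (x + y + (ax + ay) + i) + (ρ + ρ) + (k + k + (L + (2 + 1))) + 0)
  eq = solve-∀

-- The chain `2k + L ≤ E ≤ x + y + bx + by ≤ 2ρ + 4 ≤ 2k` closes up, so `L` vanishes and every
-- estimate in it is an equality.
module TightBounds (k L : ℕ) {x y bx by ρ E : ℕ} (h₁ : k * 2 + L ≤ E) (h₂ : E ≤ x + y + (bx + by))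
  (h₃ : x ≤ ρ) (h₄ : y ≤ ρ) (h₅ : ρ + 2 ≤ k) (h₆ : bx ≤ 2) (h₇ : by ≤ 2) where

  private
    combined : k * 2 + L + E + (ρ + 2 + (ρ + 2)) ≤ E + (x + y + (bx + by)) + (k + k)
    combined = +-mono-≤ (+-mono-≤ h₁ h₂) (+-mono-≤ h₅ h₅)

  L≤0 : L ≤ 0
  L≤0 = lin-≤ (k * 2 + E + ρ + ρ + 4 + x + y + bx + by) 0 (+-mono-≤ combined (+-mono-≤ (+-mono-≤ h₃ h₄) (+-mono-≤ h₆ h₇)))
    (lhs k L x y bx by ρ E) (rhs k x y bx by ρ E)
    where
    lhs : ∀ k L x y bx by ρ E → k * 2 + L + E + (ρ + 2 + (ρ + 2)) + (x + y + (bx + by))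
        ≡ k * 2 + E + ρ + ρ + 4 + x + y + bx + by + (0 + L)
    lhs = solve-∀
    rhs : ∀ k x y bx by ρ E → E + (x + y + (bx + by)) + (k + k) + (ρ + ρ + (2 + 2))
        ≡ k * 2 + E + ρ + ρ + 4 + x + y + bx + by + 0
    rhs = solve-∀

  ρ≤x : ρ ≤ x
  ρ≤x = lin-≤ (k * 2 + E + ρ + 4 + y + bx + by) L (+-mono-≤ combined (+-mono-≤ h₄ (+-mono-≤ h₆ h₇)))
    (lhs k L y bx by ρ E) (rhs k x y bx by ρ E)
    where
    lhs : ∀ k L y bx by ρ E → k * 2 + L + E + (ρ + 2 + (ρ + 2)) + (y + (bx + by))
        ≡ k * 2 + E + ρ + 4 + y + bx + by + (L + ρ)
    lhs = solve-∀
    rhs : ∀ k x y bx by ρ E → E + (x + y + (bx + by)) + (k + k) + (ρ + (2 + 2))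
        ≡ k * 2 + E + ρ + 4 + y + bx + by + x
    rhs = solve-∀

  2≤bx : 2 ≤ bx
  2≤bx = lin-≤ (k * 2 + E + ρ + ρ + 2 + x + y + by) L (+-mono-≤ combined (+-mono-≤ (+-mono-≤ h₃ h₄) h₇))
    (lhs k L x y by ρ E) (rhs k x y bx by ρ E)
    where
    lhs : ∀ k L x y by ρ E → k * 2 + L + E + (ρ + 2 + (ρ + 2)) + (x + y + by)
        ≡ k * 2 + E + ρ + ρ + 2 + x + y + by + (L + 2)
    lhs = solve-∀
    rhs : ∀ k x y bx by ρ E → E + (x + y + (bx + by)) + (k + k) + (ρ + ρ + 2)
        ≡ k * 2 + E + ρ + ρ + 2 + x + y + by + bx
    rhs = solve-∀

-- `(a + b)²` exceeds `4ab` by `(a - b)² ≤ 1`, so it stays below `4 (ab + 1)`.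
balanced⇒maximal : ∀ a b → a ≤ suc b → b ≤ suc a → a * b ≡ ((a + b) * (a + b)) / 4
balanced⇒maximal a b a≤1+b b≤1+a = ≤-antisym (am-gm a b) (≤-pred (m<n*o⇒m/o<n {n = suc (a * b)} below))
  where
  ordered : ∀ a b → a ≤ b → b ≤ suc a → (a + b) * (a + b) < suc (a * b) * 4
  ordered a b a≤b b≤1+a with m≤n⇒m<n∨m≡n a≤b
  ... | inj₂ refl = ≤-trans (m≤m+n _ 3) (≤-reflexive (eq a))
    where
    eq : ∀ a → suc ((a + a) * (a + a)) + 3 ≡ suc (a * a) * 4
    eq = solve-∀
  ... | inj₁ a<b rewrite ≤-antisym b≤1+a a<b = ≤-trans (m≤m+n _ 2) (≤-reflexive (eq a))
    where
    eq : ∀ a → suc ((a + suc a) * (a + suc a)) + 2 ≡ suc (a * suc a) * 4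
    eq = solve-∀
  below : (a + b) * (a + b) < suc (a * b) * 4
  below with ≤-total a b
  ... | inj₁ a≤b = ordered a b a≤b b≤1+a
  ... | inj₂ b≤a rewrite *-comm a b | +-comm a b = ordered b a b≤a a≤1+b

-- If `a ≥ b + 2`, then `(a - b)² ≥ 4`, so even `ab + 1` is at most the quotient.
maximal⇒balanced : ∀ a b → ((a + b) * (a + b)) / 4 ≤ a * b → a ≤ suc b
maximal⇒balanced a b max = ≮⇒≥ λ 2+b≤a → let c , eq = m≤n⇒∃[o]m+o≡n 2+b≤a in
  1+n≰n (≤-trans (quarter-≤ (subst (λ a → suc (a * b) * 4 ≤ (a + b) * (a + b)) eq (gap b c))) max)
  where
  expand : ∀ b c → suc ((suc (suc b) + c) * b) * 4 + (c * 4 + c * c) ≡ (suc (suc b) + c + b) * (suc (suc b) + c + b)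
  expand = solve-∀
  gap : ∀ b c → suc ((suc (suc b) + c) * b) * 4 ≤ (suc (suc b) + c + b) * (suc (suc b) + c + b)
  gap b c = ≤-trans (m≤m+n _ _) (≤-reflexive (expand b c))

balanced⇒half : ∀ x y → x + 2 ≤ suc y → y ≤ suc (x + 2) → x ≡ ⌊ x + y /2⌋ ∸ 1 ⊎ x ≡ ⌈ x + y /2⌉ ∸ 1
balanced⇒half x y lo hi with m≤n⇒∃[o]m+o≡n (≤-pred (subst (_≤ suc y) (+-comm x 2) lo))
-- The offset `o` is defined by `y = x + 1 + o`, so `x + y` is `2x + 1`, `2x + 2` or `2x + 3` in the
-- three possible cases.
... | 0 , refl rewrite +-identityʳ x | +-suc x x = inj₂ (n≡⌊n+n/2⌋ x)
... | 1 , refl rewrite +-comm x 1 | +-suc x (suc x) | +-suc x x = inj₁ (n≡⌊n+n/2⌋ x)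
... | 2 , refl rewrite +-comm x 2 | +-suc x (suc (suc x)) | +-suc x (suc x) | +-suc x x = inj₁ (n≡⌈n+n/2⌉ x)
... | suc (suc (suc o)) , refl = ⊥-elim (lin-⊥ o hi (eq x o))
  where
  eq : ∀ x o → suc x + suc (suc (suc o)) ≡ suc (suc (x + 2) + o)
  eq = solve-∀

half⇒balanced : ∀ n x y → 2 ≤ n → x + y ≡ n → x ≡ ⌊ n /2⌋ ∸ 1 ⊎ x ≡ ⌈ n /2⌉ ∸ 1 → x + 2 ≤ suc y × y ≤ suc (x + 2)
half⇒balanced (suc zero)    x y (s≤s ())
-- With two units split off, both halves minus 1 compute to the halves of the smaller `n`, and
-- truncated subtraction disappears.
half⇒balanced (suc (suc n)) x y _ x+y≡n = λ
  { (inj₁ refl) → from-y ⌊ n /2⌋ (suc ⌈ n /2⌉) (trans (+-suc _ _) (cong suc (⌊n/2⌋+⌈n/2⌉≡n n))) x+y≡n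
                    (s≤s (≤-trans (⌊n/2⌋≤⌈n/2⌉ n) (n≤1+n _))) (s≤s near)
  ; (inj₂ refl) → from-y ⌈ n /2⌉ (suc ⌊ n /2⌋) (trans (+-comm ⌈ n /2⌉ _) (cong suc (⌊n/2⌋+⌈n/2⌉≡n n))) x+y≡n
                    (s≤s near) (s≤s (≤-trans (⌊n/2⌋≤⌈n/2⌉ n) (n≤1+n _))) }
  where
  near : ⌈ n /2⌉ ≤ suc ⌊ n /2⌋
  near = ⌊n/2⌋-mono (n≤1+n (suc n))
  from-y : ∀ x z → x + z ≡ suc n → x + y ≡ suc (suc n) → suc x ≤ suc z → z ≤ suc (suc x) →
           x + 2 ≤ suc y × y ≤ suc (x + 2)
  from-y x z x+z x+y lo hi
    rewrite +-cancelˡ-≡ x y (suc z) (trans x+y (trans (cong suc (sym x+z)) (sym (+-suc x z)))) | +-comm x 2 =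
      s≤s lo , s≤s hi

-- Vertices of maximum in-degree

-- Everything in ExtremalPartition except the size of X.
Split : Digraph n → (Fin n → Bool) → Set
Split {n} A X =
    ((x y : Fin n) → X x ≡ true → X y ≡ false → A x y ≡ true)
  × ((x y : Fin n) → X x ≡ true → X y ≡ true → A x y ≡ false)
  × ((y : Fin n) → X y ≡ false → inDegIn A (λ u → not (X u)) y ≡ 2)

module MaximumInDegree {n : ℕ} (A : Digraph n) (ori : IsOriented A) (free : Free A (S⃗ 3)) (n≥40 : n ≥ 40)
  (v : Fin n) (max : ∀ u → InPaths.d A u ≤ InPaths.d A v)
  (many : ((n + 2) * (n + 2)) / 4 ≤ sumFin (InPaths.d A)) where

  open InPaths A
  open Oriented ori
  open NoS31 free

  k : ℕ
  k = d v

  N : Fin n → Bool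
  N w = A w v

  loss : Fin n → ℕ
  loss u = if N u then 0 else k ∸ d u

  E L σ : ℕ
  E = sumFin (through v)
  L = sumFin loss
  σ = count (λ u → not (N u) ∧ not (big u))

  through-N : ∀ {u} → N u ≡ true → through v u ≡ d u
  through-N {u} Nu = count-cong λ z → trans (cong (A z u ∧_) Nu) (Bool.∧-identityʳ _)

  through-¬N : ∀ {u} → N u ≡ false → through v u ≡ 0
  through-¬N {u} ¬Nu = count-false λ z → trans (cong (A z u ∧_) ¬Nu) (Bool.∧-zeroʳ _)

  -- This is the exact form of the bound `k (n - k) + E`, free of subtraction. A vertex in `N`
  -- contributes `d u + k` to either side, a vertex outside contributes `k`.
  balance : sumFin d + L + k * k ≡ E + n * k
  balance = begin
    sumFin d + L + k * k                                        ≡⟨ cong₂ _+_ (sym (sum-+ d loss)) (sym (trans (sum-*ˡ k (λ u → ⟦ N u ⟧)) (cong (k *_) (sym (count-sum N))))) ⟩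
    sumFin (λ u → d u + loss u) + sumFin (λ u → k * ⟦ N u ⟧)    ≡⟨ sym (sum-+ (λ u → d u + loss u) _) ⟩
    sumFin (λ u → d u + loss u + k * ⟦ N u ⟧)                   ≡⟨ sum-cong pointwise ⟩
    sumFin (λ u → through v u + k)                              ≡⟨ sum-+ (through v) _ ⟩
    E + sumFin {n} (λ _ → k)                                    ≡⟨ cong (E +_) (sum-const n k) ⟩
    E + n * k                                                   ∎
    where
    open ≡-Reasoning
    pointwise : ∀ u → d u + loss u + k * ⟦ N u ⟧ ≡ through v u + k
    pointwise u with N u in Nu
    ... | true  = cong₂ _+_ (trans (+-identityʳ _) (sym (through-true u))) (*-identityʳ k)
      where
      through-true : ∀ u → count (λ z → A z u ∧ true) ≡ d u
      through-true u = count-cong λ z → Bool.∧-identityʳ (A z u)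
    ... | false = trans (cong₂ _+_ (m+[n∸m]≡n (max u)) (*-zeroʳ k))
                        (trans (+-identityʳ k) (cong (_+ k) (sym (count-false λ z → Bool.∧-zeroʳ (A z u)))))

  k≥9 : 9 ≤ k
  k≥9 = many-arcs⇒k≥9 n≥40 many (≤-trans (sum-mono max) (≤-reflexive (sum-const n k)))

  E-bounds : k * 2 + L ≤ E × 41 + L ≤ E
  E-bounds with m≤n⇒∃[o]m+o≡n (count≤n N)
  ... | j , k+j≡n =
      -- Both factorisations `k * (j + 2)` and `suc k * suc j` have factors with sum `n + 2`, so
      -- each is at most the claimed maximum.
      excess≥2k k j L many balance′ (subst (λ s → k * (j + 2) ≤ s * s / 4) sum₁ (am-gm k (j + 2)))
    , ≤-trans (+-monoˡ-≤ L (s≤s (subst (40 ≤_) (sym k+j≡n) n≥40)))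
        (excess>n k j L many balance′ (subst (λ s → suc k * suc j ≤ s * s / 4) sum₂ (am-gm (suc k) (suc j))))
    where
    balance′ : sumFin d + L + k * k ≡ E + (k + j) * k
    balance′ = trans balance (cong (λ m → E + m * k) (sym k+j≡n))
    sum₁ : k + (j + 2) ≡ n + 2
    sum₁ = trans (sym (+-assoc k j 2)) (cong (_+ 2) k+j≡n)
    sum₂ : suc k + suc j ≡ n + 2
    sum₂ = trans (eq k j) (cong (_+ 2) k+j≡n)
      where
      eq : ∀ k j → suc k + suc j ≡ k + j + 2
      eq = solve-∀

  ¬big⇒d≤4 : ∀ {u} → big u ≡ false → d u ≤ 4
  ¬big⇒d≤4 {u} eq = ≤-pred (≰⇒> λ 5≤d → subst T eq (≤⇒≤ᵇ 5≤d))

  d≥5⇒big : ∀ {u} → 5 ≤ d u → big u ≡ true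
  d≥5⇒big {u} 5≤d with big u in eq
  ... | true  = refl
  ... | false = ⊥-elim (subst T eq (≤⇒≤ᵇ 5≤d))

  5σ≤L : σ * 5 ≤ L
  5σ≤L = begin
    σ * 5                                              ≡⟨ *-comm σ 5 ⟩
    5 * σ                                              ≡⟨ cong (5 *_) (count-sum (λ u → not (N u) ∧ not (big u))) ⟩
    5 * sumFin (λ u → ⟦ not (N u) ∧ not (big u) ⟧)      ≡⟨ sym (sum-*ˡ 5 (λ u → ⟦ not (N u) ∧ not (big u) ⟧)) ⟩
    sumFin (λ u → 5 * ⟦ not (N u) ∧ not (big u) ⟧)      ≤⟨ sum-mono pointwise ⟩
    L                                                  ∎
    where
    open ≤-Reasoning
    pointwise : ∀ u → 5 * ⟦ not (N u) ∧ not (big u) ⟧ ≤ loss u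
    pointwise u with N u | big u in eq
    ... | true  | _     = z≤n
    ... | false | true  = z≤n
    ... | false | false = ∸-mono k≥9 (¬big⇒d≤4 eq)

  -- For `p` in `N`, the in-neighbours of `p`, its out-neighbours in `N` and `p` itself are
  -- disjoint. They fit into `N` except for in-neighbours outside `N`, which are big, hence at most
  -- two, or counted by `σ`.
  degree-bound : ∀ p → suc (through v p + from v p) ≤ k + (2 + σ)
  degree-bound p with N p in Np
  ... | false = ≤-trans (s≤s (+-mono-≤ (≤-reflexive (count-false λ z → Bool.∧-zeroʳ (A z p)))
                          (count-≤ 2 (λ { (a ∷ b ∷ []) → true , a ∧ b ∷ [] , b ∷ [] }) tt
                             (λ w → A p w ∷ N w ∷ []) (λ _ → refl))))
                        (≤-trans (m≤n+m _ (1 + σ)) (≤-reflexive (eq k σ)))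
    where
    eq : ∀ k σ → 1 + σ + suc k ≡ k + (2 + σ)
    eq = solve-∀
  ... | true  = begin
    suc (count (λ z → A z p ∧ true) + from v p)      ≡⟨ cong (λ c → suc (c + from v p)) (count-cong λ z → Bool.∧-identityʳ (A z p)) ⟩
    suc (d p + from v p)                             ≡⟨ trans (sym (+-comm (d p + from v p) 1)) (+-assoc (d p) (from v p) 1) ⟩
    d p + (from v p + 1)                             ≡⟨ cong (λ c → d p + (from v p + c)) (sym (count-single p)) ⟩
    d p + (from v p + count (_== p))                 ≤⟨ count-≤ 5 (λ { (a ∷ b ∷ x ∷ g ∷ e ∷ []) →
                                                          not (a ∧ b) ∧ (e ⇒ x ∧ not a ∧ not b)
                                                          , a ∷ b ∧ x ∷ e ∷ []
                                                          , x ∷ a ∧ g ∷ not x ∧ not g ∷ [] }) tt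
                                                          (λ z → A z p ∷ A p z ∷ N z ∷ big z ∷ z == p ∷ [])
                                                          (λ z → antisym z p & ==-elim (λ z → N z ∧ not (A z p) ∧ not (A p z)) p
                                                             (Np & not-true (proj₁ ori p) & not-true (proj₁ ori p)) z) ⟩
    k + (bigIn p + σ)                                ≤⟨ +-monoʳ-≤ k (+-monoˡ-≤ σ (bigIn≤2 p)) ⟩
    k + (2 + σ)                                      ∎
    where open ≤-Reasoning

  ¬high⇒degree≤8 : ∀ {u} → ¬ High v u → through v u + from v u ≤ 8
  ¬high⇒degree≤8 ¬hi = +-mono-≤ (≤-pred (≰⇒> (¬hi ∘ inj₁))) (≤-pred (≰⇒> (¬hi ∘ inj₂)))

  uncovered-path : (U : List (Fin n)) →
    (∃ λ (e : Path v) → Avoids e U) ⊎ E ≤ sum (map (λ u → through v u + from v u) U)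
  uncovered-path U with uncovered-pair (λ z w → A z w ∧ A w v) U
  ... | inj₂ le = inj₂ le
  ... | inj₁ (z , w , arcs , z∉U , w∉U) with ∧-true (A z w) arcs
  ...   | zw , wv = inj₁ (path zw wv , z∉U , w∉U)

  -- Greedy choice of disjoint paths stops before the third one. With no high vertex, at most four
  -- vertices of degree at most 8 cover everything, so `E ≤ 32`; with a single one, `p` and at most
  -- two others do, whence the 16.
  two-high : ∃ λ p → ∃ λ q → High v p × High v q × p ≢ q
  two-high with any? (high? v)
  ... | no none = ⊥-elim no-high
    where
    deg≤8 : ∀ u → through v u + from v u ≤ 8
    deg≤8 u = ¬high⇒degree≤8 λ hu → none (u , hu)
    few : ∀ U → length U ≤ 4 → E ≤ sum (map (λ u → through v u + from v u) U) → ⊥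
    few U U≤4 le = lin-⊥ 8 (≤-trans (m+n≤o⇒m≤o 41 (proj₂ E-bounds)) (≤-trans le (≤-trans (total U) (*-monoˡ-≤ 8 U≤4)))) refl
      where
      total : ∀ U → sum (map (λ u → through v u + from v u) U) ≤ length U * 8
      total []      = z≤n
      total (u ∷ U) = +-mono-≤ (deg≤8 u) (total U)
    no-high : ⊥
    no-high with uncovered-path []
    ... | inj₂ le = few [] z≤n le
    ... | inj₁ (e₁ , _) with uncovered-path (verts e₁)
    ...   | inj₂ le = few (verts e₁) (s≤s (s≤s z≤n)) le
    ...   | inj₁ (e₂ , e₂∉) with uncovered-path (verts e₂ ++ verts e₁)
    ...     | inj₂ le = few (verts e₂ ++ verts e₁) ≤-refl le
    ...     | inj₁ (e₃ , e₃∉) = no-3-paths e₁ e₂ e₃ e₂∉ e₃∉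
  ... | yes (p , hp) with any? (λ q → high? v q ×-dec ¬? (p ≟ q))
  ...   | yes (q , hq , p≢q) = p , q , hp , hq , p≢q
  ...   | no none = ⊥-elim one-high
    where
    deg≤8 : ∀ u → u ≢ p → through v u + from v u ≤ 8
    deg≤8 u u≢p = ¬high⇒degree≤8 λ hu → none (u , hu , u≢p ∘ sym)
    few : E ≤ (through v p + from v p) + 16 → ⊥
    few le = one-high-⊥ k L σ (proj₁ E-bounds) (proj₂ E-bounds) le (degree-bound p) 5σ≤L
    one-high : ⊥
    one-high with uncovered-path (p ∷ [])
    ... | inj₂ le = few (≤-trans le (+-monoʳ-≤ _ z≤n))
    ... | inj₁ (e₁ , (z₁p ∷ [] , w₁p ∷ [])) with uncovered-path (p ∷ verts e₁)
    ...   | inj₂ le = few (≤-trans le (+-monoʳ-≤ _ (+-mono-≤ (deg≤8 _ z₁p) (+-mono-≤ (deg≤8 _ w₁p) z≤n))))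
    ...   | inj₁ (e₂ , (z₂p ∷ z₂∉ , w₂p ∷ w₂∉)) =
      no-2-paths-1-high e₁ e₂ (z₂∉ , w₂∉) hp (z₁p ∷ [] , w₁p ∷ []) (z₂p ∷ [] , w₂p ∷ [])

  -- Two high vertices at `v`

  module TwoHigh (p q : Fin n) (high-p : High v p) (high-q : High v q) (p≢q : p ≢ q) where

    E≤degrees : E ≤ (through v p + from v p) + ((through v q + from v q) + 0)
    E≤degrees with uncovered-path (p ∷ q ∷ [])
    ... | inj₂ le       = le
    ... | inj₁ (e , e∉) = ⊥-elim (no-1-path-2-high e high-p high-q p≢q e∉)

    L≤2 : L ≤ 2
    L≤2 = two-high-loss k L σ (proj₁ E-bounds) E≤degrees (degree-bound p) (degree-bound q) 5σ≤L

    k≥20 : 20 ≤ k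
    k≥20 = two-high-k k L σ (proj₂ E-bounds) E≤degrees (degree-bound p) (degree-bound q) 5σ≤L

    outside-loss : ∀ {u} → N u ≡ false → k ≤ d u + L
    outside-loss {u} ¬Nu = ≤-trans (m≤n+m∸n k (d u))
      (+-monoʳ-≤ (d u) (≤-trans (≤-reflexive (cong (if_then 0 else (k ∸ d u)) (sym ¬Nu))) (term≤sum loss u)))

    outside-big : ∀ {u} → N u ≡ false → big u ≡ true
    outside-big {u} ¬Nu = d≥5⇒big (≤-trans (m≤n+m 5 13)
      (+-cancelʳ-≤ 2 18 (d u) (≤-trans k≥20 (≤-trans (outside-loss ¬Nu) (+-monoʳ-≤ (d u) L≤2)))))

    N∨big : ∀ u → (not (N u) ⇒ big u) ≡ true
    N∨big u with N u in Nu
    ... | true  = refl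
    ... | false = outside-big Nu

    -- Outside `N`, a high `x` has at least five out-neighbours in `N`, which are not in-neighbours.
    -- At most two in-neighbours lie outside `N`, so `d x ≤ k - 3`, against a loss of at most 2.
    high⇒N : ∀ {x} → High v x → N x ≡ true
    high⇒N {x} hx = Bool.¬-not λ ¬Nx → outside-⊥ k
        ([ (λ hi → ⊥-elim (n≮0 (subst (5 ≤_) (through-¬N ¬Nx) hi))) , (λ hi → hi) ]′ hx)
        (count-≤ 4 (λ { (a ∷ b ∷ c ∷ g ∷ []) → not (b ∧ a) ∧ (not c ⇒ g) , a ∧ c ∷ b ∷ [] , c ∷ b ∧ g ∷ [] }) tt
           (λ w → A x w ∷ A w x ∷ N w ∷ big w ∷ []) (λ w → antisym w x & N∨big w))
        (≤-trans (outside-loss ¬Nx) (+-monoʳ-≤ (d x) L≤2)) (bigIn≤2 x)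

    R : Fin n → Bool
    R w = N w ∧ (not (w == p) ∧ not (w == q))

    r⁻ r⁺ a : Fin n → ℕ
    r⁻ x = count (λ w → R w ∧ A w x)
    r⁺ x = count (λ w → R w ∧ A x w)
    a  x = count (λ w → not (N w) ∧ A w x)

    R+2≤k : count R + 2 ≤ k
    R+2≤k = subst₂ (λ c c′ → count R + (c + c′) ≤ k) (count-single p) (count-single q)
      (count-≤ 3 (λ { (c ∷ e ∷ f ∷ []) → (e ⇒ c ∧ not f) ∧ (f ⇒ c) , c ∧ (not e ∧ not f) ∷ e ∷ f ∷ [] , c ∷ [] }) tt
         (λ w → N w ∷ w == p ∷ w == q ∷ [])
         (λ w → ==-elim (λ w → N w ∧ not (w == q)) p (high⇒N high-p & ≢⇒not-== p≢q) w
              & ==-elim N q (high⇒N high-q) w))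

    -- An arc into `w` from any other tail would start a path to `v` avoiding both high vertices.
    R-indegree : ∀ {w} → R w ≡ true → d w ≤ ⟦ A p w ⟧ + ⟦ A q w ⟧
    R-indegree {w} Rw with ∧-true (N w) Rw
    ... | Nw , ≠pq with ∧-true (not (w == p)) ≠pq
    ...   | w≠p , w≠q = begin
      d w                                                              ≤⟨ count-remove (λ z → A z w) p ⟩
      count (λ z → A z w ∧ not (z == p)) + ⟦ A p w ⟧                    ≤⟨ +-monoˡ-≤ ⟦ A p w ⟧ (count-remove (λ z → A z w ∧ not (z == p)) q) ⟩
      count (λ z → (A z w ∧ not (z == p)) ∧ not (z == q)) + ⟦ A q w ∧ not (q == p) ⟧ + ⟦ A p w ⟧
                                                                       ≡⟨ cong (λ c → c + ⟦ A q w ∧ not (q == p) ⟧ + ⟦ A p w ⟧) (count-false none) ⟩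
      ⟦ A q w ∧ not (q == p) ⟧ + ⟦ A p w ⟧                              ≡⟨ cong (λ b → ⟦ A q w ∧ b ⟧ + ⟦ A p w ⟧) (≢⇒not-== (p≢q ∘ sym)) ⟩
      ⟦ A q w ∧ true ⟧ + ⟦ A p w ⟧                                      ≡⟨ cong (λ b → ⟦ b ⟧ + ⟦ A p w ⟧) (Bool.∧-identityʳ (A q w)) ⟩
      ⟦ A q w ⟧ + ⟦ A p w ⟧                                             ≡⟨ +-comm ⟦ A q w ⟧ ⟦ A p w ⟧ ⟩
      ⟦ A p w ⟧ + ⟦ A q w ⟧                                             ∎
      where
      open ≤-Reasoning
      none : ∀ z → (A z w ∧ not (z == p)) ∧ not (z == q) ≡ false
      none z = Bool.¬-not λ eq → let
        eq₁ , z≠q = ∧-true (A z w ∧ not (z == p)) eq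
        zw  , z≠p = ∧-true (A z w) eq₁
        in no-1-path-2-high (path zw Nw) high-p high-q p≢q
             (not-==⇒≢ z≠p ∷ not-==⇒≢ z≠q ∷ [] , not-==⇒≢ w≠p ∷ not-==⇒≢ w≠q ∷ [])

    -- Arcs into `N` are sorted by head: `p` and `q` receive their full in-degrees, and a head in
    -- `R` has only `p` and `q` as possible tails.
    E≤pq : E ≤ (d p + d q) + (r⁺ p + r⁺ q)
    E≤pq = ≤-trans (sum-mono pointwise) (≤-reflexive total)
      where
      at : Fin n → Fin n → ℕ
      at u w = if w == u then through v w else 0
      pointwise : ∀ w → through v w ≤ (at p w + at q w) + (⟦ R w ∧ A p w ⟧ + ⟦ R w ∧ A q w ⟧)
      pointwise w = split (N w) refl (w ≟ p) (w ≟ q)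
        where
        split : ∀ b → N w ≡ b → (e : Dec (w ≡ p)) (f : Dec (w ≡ q)) → through v w ≤
                ((if does e then through v w else 0) + (if does f then through v w else 0))
                + (⟦ (N w ∧ (not (does e) ∧ not (does f))) ∧ A p w ⟧ + ⟦ (N w ∧ (not (does e) ∧ not (does f))) ∧ A q w ⟧)
        split _     _  (yes _)   _         = ≤-trans (m≤m+n _ _) (m≤m+n _ _)
        split _     _  (no _)    (yes _)   = m≤m+n _ _
        split false Nw (no _)    (no _)    = ≤-trans (≤-reflexive (through-¬N Nw)) z≤n
        split true  Nw (no w≢p)  (no w≢q)  rewrite Nw =
          ≤-trans (≤-reflexive (count-cong λ z → Bool.∧-identityʳ (A z w)))
                  (R-indegree (Nw & ≢⇒not-== w≢p & ≢⇒not-== w≢q))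
      total : sumFin (λ w → (at p w + at q w) + (⟦ R w ∧ A p w ⟧ + ⟦ R w ∧ A q w ⟧)) ≡ (d p + d q) + (r⁺ p + r⁺ q)
      total = trans (sum-+ (λ w → at p w + at q w) _) (cong₂ _+_
        (trans (sum-+ (at p) (at q)) (cong₂ _+_
          (trans (sum-single (through v) p) (through-N (high⇒N high-p)))
          (trans (sum-single (through v) q) (through-N (high⇒N high-q)))))
        (trans (sum-+ (λ w → ⟦ R w ∧ A p w ⟧) _) (cong₂ _+_ (sym (count-sum (λ w → R w ∧ A p w))) (sym (count-sum (λ w → R w ∧ A q w))))))

    -- The pair (x , y) is (p , q) or (q , p).
    record Sides (x y : Fin n) : Set where
      field
        high-x : High v x
        high-y : High v y
        x≢y    : x ≢ y
        R-spec : ∀ w → R w ≡ N w ∧ (not (w == x) ∧ not (w == y))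
        E≤     : E ≤ (d x + d y) + (r⁺ x + r⁺ y)

    pq-sides : Sides p q
    pq-sides = record { high-x = high-p ; high-y = high-q ; x≢y = p≢q ; R-spec = λ _ → refl ; E≤ = E≤pq }

    swap : ∀ {x y} → Sides x y → Sides y x
    swap {x} {y} s = record
      { high-x = high-y ; high-y = high-x ; x≢y = x≢y ∘ sym
      ; R-spec = λ w → trans (R-spec w) (cong (N w ∧_) (Bool.∧-comm (not (w == x)) _))
      ; E≤     = subst (E ≤_) (cong₂ _+_ (+-comm (d x) (d y)) (+-comm (r⁺ x) (r⁺ y))) E≤ }
      where open Sides s

    adjacent≤R : ∀ x → r⁻ x + r⁺ x ≤ count R
    adjacent≤R x = count-≤ 3 (λ { (r ∷ b ∷ c ∷ []) → not (b ∧ c) , r ∧ b ∷ r ∧ c ∷ [] , r ∷ [] }) tt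
      (λ w → R w ∷ A w x ∷ A x w ∷ []) (λ w → antisym w x)

    indegree-split : ∀ {x y} → Sides x y → d x ≤ r⁻ x + (a x + ⟦ A y x ⟧)
    indegree-split {x} {y} s = subst (λ c → d x ≤ r⁻ x + (a x + c)) (count-at (λ w → A w x) y)
      (count-≤ 5 (λ { (b ∷ r ∷ c ∷ e ∷ f ∷ []) →
           iff r (c ∧ (not e ∧ not f)) ∧ (e ⇒ not b) , b ∷ [] , r ∧ b ∷ not c ∧ b ∷ f ∧ b ∷ [] }) tt
         (λ w → A w x ∷ R w ∷ N w ∷ w == x ∷ w == y ∷ [])
         (λ w → ≡⇒iff (R-spec w) & ==-elim (λ w → not (A w x)) x (not-true (proj₁ ori x)) w))
      where open Sides s

    a+y≤bigIn : ∀ {x y} → Sides x y → a x + ⟦ A y x ∧ big y ⟧ ≤ bigIn x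
    a+y≤bigIn {x} {y} s = subst (λ c → a x + c ≤ bigIn x) (count-at (λ w → A w x ∧ big w) y)
      (count-≤ 4 (λ { (c ∷ b ∷ g ∷ e ∷ []) → (not c ⇒ g) ∧ (e ⇒ c) , not c ∧ b ∷ e ∧ (b ∧ g) ∷ [] , b ∧ g ∷ [] }) tt
         (λ w → N w ∷ A w x ∷ big w ∷ w == y ∷ []) (λ w → N∨big w & ==-elim N y (high⇒N high-y) w))
      where open Sides s

    a≤2 : ∀ {x y} → Sides x y → a x ≤ 2
    a≤2 {x} s = ≤-trans (m≤m+n _ _) (≤-trans (a+y≤bigIn s) (bigIn≤2 x))

    E≤adjacent : ∀ {x y} → Sides x y →
                 E ≤ (r⁻ x + r⁺ x) + (r⁻ y + r⁺ y) + (a x + a y) + (⟦ A y x ⟧ + ⟦ A x y ⟧)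
    E≤adjacent {x} {y} s = ≤-trans E≤ (≤-trans
      (+-monoˡ-≤ (r⁺ x + r⁺ y) (+-mono-≤ (indegree-split s) (indegree-split (swap s))))
      (≤-reflexive (eq (r⁻ x) (r⁺ x) (r⁻ y) (r⁺ y) (a x) (a y) ⟦ A y x ⟧ ⟦ A x y ⟧)))
      where
      open Sides s
      eq : ∀ x⁻ x⁺ y⁻ y⁺ ax ay i j → x⁻ + (ax + i) + (y⁻ + (ay + j)) + (x⁺ + y⁺) ≡ x⁻ + x⁺ + (y⁻ + y⁺) + (ax + ay) + (i + j)
      eq = solve-∀

    one-arc : ∀ x y → ⟦ A y x ⟧ + ⟦ A x y ⟧ ≤ 1
    one-arc x y with A y x in yx
    ... | true  = ≤-reflexive (cong (λ b → suc ⟦ b ⟧) (proj₂ ori y x yx))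
    ... | false = ⟦⟧≤1 (A x y)

    -- At most four in-neighbours of a small `x` lie in `R`, so out-arcs to `R` must make up the
    -- rest of `E ≥ 2k`. The constant is `4 + 2 + 2 + 1 - 2`.
    small⇒k≤r⁺+7 : ∀ {x y} → Sides x y → big x ≡ false → k ≤ r⁺ x + 7
    small⇒k≤r⁺+7 {x} {y} s sx = small⇒r⁺-large k (m+n≤o⇒m≤o _ (proj₁ E-bounds)) (E≤adjacent s) (adjacent≤R y) R+2≤k
      (a≤2 s) (a≤2 (swap s)) (one-arc x y)
      (count-≤ 2 (λ { (r ∷ b ∷ []) → true , r ∧ b ∷ [] , b ∷ [] }) tt (λ w → R w ∷ A w x ∷ []) (λ _ → refl))
      (¬big⇒d≤4 sx)

    -- The arc `u → x` rules out `x`. Any other in-neighbour of `u` lies in `R`, is `y`, or lies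
    -- outside `N` and is therefore big.
    outside-indegree : ∀ {x y u} → Sides x y → A u x ≡ true →
      d u ≤ count (λ w → R w ∧ A w u) + (⟦ A y u ∧ not (big y) ⟧ + bigIn u)
    outside-indegree {x} {y} {u} s ux =
      subst (λ c → d u ≤ count (λ w → R w ∧ A w u) + (c + bigIn u)) (count-at (λ w → A w u ∧ not (big w)) y)
      (count-≤ 6 (λ { (b ∷ r ∷ c ∷ g ∷ e ∷ f ∷ []) →
           iff r (c ∧ (not e ∧ not f)) ∧ (e ⇒ not b) ∧ (not c ⇒ g)
           , b ∷ [] , r ∧ b ∷ f ∧ (b ∧ not g) ∷ b ∧ g ∷ [] }) tt
         (λ w → A w u ∷ R w ∷ N w ∷ big w ∷ w == x ∷ w == y ∷ [])
         (λ w → ≡⇒iff (R-spec w) & ==-elim (λ w → not (A w u)) x (not-true (proj₂ ori u x ux)) w & N∨big w))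
      where open Sides s

    high-at : ∀ {x y u} → Sides x y → big x ≡ false → k ≤ count (λ w → R w ∧ A w u) + 3 → High u x
    high-at {x} {u = u} s sx k≤t+3 = inj₂ (common-large k k≥20 (small⇒k≤r⁺+7 s sx) k≤t+3
      (count-≤ 3 (λ { (r ∷ b ∷ c ∷ []) → true , r ∧ b ∷ r ∧ c ∷ [] , r ∷ b ∧ c ∷ [] }) tt
         (λ w → R w ∷ A x w ∷ A w u ∷ []) (λ _ → refl))
      R+2≤k)

    -- A small x sends arcs to most of R, so it takes one of the two places of the big in-neighbours of u.
    small⇒loss : ∀ {x y u} → Sides x y → big x ≡ false → A u x ≡ true → suc (d u) ≤ k
    small⇒loss {x} {y} {u} s sx ux = ≰⇒> λ k≤d → lin-⊥ 0
        (+-mono-≤ (≤-trans k≤d (outside-indegree s ux)) (+-mono-≤ R+2≤k (+-mono-≤ t≤R (few k≤d))))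
        (eq k t (⟦ A y u ∧ not (big y) ⟧ + bigIn u) (count R))
      where
      open Sides s
      eq : ∀ k t i ρ → k + (ρ + 2 + (t + i)) ≡ suc (t + i + (k + (ρ + 1)) + 0)
      eq = solve-∀
      t : ℕ
      t = count (λ w → R w ∧ A w u)
      t≤R : t ≤ count R
      t≤R = count-≤ 2 (λ { (r ∷ b ∷ []) → true , r ∧ b ∷ [] , r ∷ [] }) tt (λ w → R w ∷ A w u ∷ []) (λ _ → refl)
      few : k ≤ d u → ⟦ A y u ∧ not (big y) ⟧ + bigIn u ≤ 1
      few k≤d = by-size (big y) refl
        where
        k≤t+3 : k ≤ t + 3
        k≤t+3 = ≤-trans k≤d (≤-trans (outside-indegree s ux) (+-monoʳ-≤ t (+-mono-≤ (⟦⟧≤1 (A y u ∧ not (big y))) (bigIn≤2 u))))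
        -- If `y` is small as well, `x` and `y` occupy both places and `u` has no big in-neighbour
        -- left.
        by-size : ∀ b → big y ≡ b → ⟦ A y u ∧ not (big y) ⟧ + bigIn u ≤ 1
        by-size true  by = ≤-trans (≤-reflexive (cong (λ b → ⟦ b ⟧ + bigIn u)
                              (trans (cong (λ b → A y u ∧ not b) by) (Bool.∧-zeroʳ (A y u)))))
                            (bigIn≤1 (high-at s sx k≤t+3) sx)
        by-size false sy = +-mono-≤ (⟦⟧≤1 (A y u ∧ not (big y)))
                             (bigIn≤0 (high-at s sx k≤t+3) sx (high-at (swap s) sy k≤t+3) sy x≢y)

    -- If `x` is small, each in-neighbour outside `N` costs at least 1 in `L`, so `a x ≤ L`. Then
    -- `2k + L ≤ E ≤ 2 |R| + L + 2 + 1`, although `|R| ≤ k - 2`.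
    high⇒big : ∀ {x y} → Sides x y → big x ≡ true
    high⇒big {x} {y} s with big x in sx
    ... | true  = refl
    ... | false = ⊥-elim (small-⊥ k L (proj₁ E-bounds) (E≤adjacent s) (adjacent≤R x) (adjacent≤R y) R+2≤k
                           a≤L (a≤2 (swap s)) (one-arc x y))
      where
      a≤L : a x ≤ L
      a≤L = ≤-trans (≤-reflexive (count-sum (λ w → not (N w) ∧ A w x))) (sum-mono pointwise)
        where
        pointwise : ∀ w → ⟦ not (N w) ∧ A w x ⟧ ≤ loss w
        pointwise w with N w | A w x in wx
        ... | true  | _     = z≤n
        ... | false | false = z≤n
        ... | false | true  = m<n⇒0<n∸m (small⇒loss s sx wx)

    ⟦A∧big⟧ : ∀ {x y} → Sides x y → ⟦ A y x ∧ big y ⟧ ≡ ⟦ A y x ⟧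
    ⟦A∧big⟧ {x} {y} s = cong ⟦_⟧ (trans (cong (A y x ∧_) (high⇒big (swap s))) (Bool.∧-identityʳ (A y x)))

    a+y≤2 : ∀ {x y} → Sides x y → a x + ⟦ A y x ⟧ ≤ 2
    a+y≤2 {x} s = subst (λ c → a x + c ≤ 2) (⟦A∧big⟧ s) (≤-trans (a+y≤bigIn s) (bigIn≤2 x))

    tight : ∀ {x y} → Sides x y → L ≤ 0 × count R ≤ r⁻ x + r⁺ x × 2 ≤ a x + ⟦ A y x ⟧
    tight {x} {y} s = L≤0 , ρ≤x , 2≤bx
      where
      eq : ∀ x⁺⁻ y⁺⁻ ax ay i j → x⁺⁻ + y⁺⁻ + (ax + ay) + (i + j) ≡ x⁺⁻ + y⁺⁻ + (ax + i + (ay + j))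
      eq = solve-∀
      open TightBounds k L (proj₁ E-bounds)
        (≤-trans (E≤adjacent s) (≤-reflexive (eq (r⁻ x + r⁺ x) (r⁻ y + r⁺ y) (a x) (a y) ⟦ A y x ⟧ ⟦ A x y ⟧)))
        (adjacent≤R x) (adjacent≤R y) R+2≤k (a+y≤2 s) (a+y≤2 (swap s))

    -- Structure in the tight case

    ¬R-cases : ∀ {y} → R y ≡ false → N y ≡ false ⊎ y ≡ p ⊎ y ≡ q
    ¬R-cases {y} ¬Ry with N y | y ≟ p | y ≟ q
    ... | false | _       | _       = inj₁ refl
    ... | true  | yes y≡p | _       = inj₂ (inj₁ y≡p)
    ... | true  | no _    | yes y≡q = inj₂ (inj₂ y≡q)

    -- This identifies `bigIn` with the in-degree inside the complement of `R`, which must turn out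
    -- to be 2.
    big≡¬R : ∀ w → big w ≡ not (R w)
    big≡¬R w with R w in Rw
    ... | true  = Bool.¬-not λ bw → n≮0 (≤-pred (≤-pred (≤-trans (≤ᵇ⇒≤ 5 (d w) (subst T (sym bw) tt))
                    (≤-trans (R-indegree Rw) (+-mono-≤ (⟦⟧≤1 (A p w)) (⟦⟧≤1 (A q w)))))))
    ... | false = [ outside-big , [ (λ { refl → high⇒big pq-sides }) , (λ { refl → high⇒big (swap pq-sides) }) ]′ ]′ (¬R-cases Rw)

    -- As `L = 0`, the chain `k ≤ d u ≤ t + bigIn u ≤ |R| + 2 ≤ k` is tight in both summands.
    outside-tight : ∀ {u} → N u ≡ false → (∀ x → R x ≡ true → A x u ≡ true) × 2 ≤ bigIn u
    outside-tight {u} ¬Nu = count-full R (λ x → A x u) R≤t , 2≤b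
      where
      t : ℕ
      t = count (λ w → R w ∧ A w u)
      k≤t+b : k ≤ t + bigIn u
      k≤t+b = ≤-trans (outside-loss ¬Nu) (≤-trans (+-monoʳ-≤ (d u) (proj₁ (tight pq-sides))) (≤-trans (≤-reflexive (+-identityʳ (d u)))
        (count-≤ 3 (λ { (b ∷ r ∷ g ∷ []) → iff g (not r) , b ∷ [] , r ∧ b ∷ b ∧ g ∷ [] }) tt
           (λ w → A w u ∷ R w ∷ big w ∷ []) (λ w → ≡⇒iff (big≡¬R w)))))
      R≤t : count R ≤ t
      R≤t = +-cancelʳ-≤ 2 _ _ (≤-trans R+2≤k (≤-trans k≤t+b (+-monoʳ-≤ t (bigIn≤2 u))))
      2≤b : 2 ≤ bigIn u
      2≤b = +-cancelˡ-≤ (count R) _ _ (≤-trans R+2≤k (≤-trans k≤t+b (+-monoˡ-≤ (bigIn u)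
        (count-≤ 2 (λ { (r ∷ b ∷ []) → true , r ∧ b ∷ [] , r ∷ [] }) tt (λ w → R w ∷ A w u ∷ []) (λ _ → refl)))))

    R-adjacent : ∀ {x y w} → Sides x y → R w ≡ true → A w x ∨ A x w ≡ true
    R-adjacent {x} s = count-full R (λ w → A w x ∨ A x w)
      (≤-trans (proj₁ (proj₂ (tight s)))
        (count-≤ 3 (λ { (r ∷ b ∷ c ∷ []) → not (b ∧ c) , r ∧ b ∷ r ∧ c ∷ [] , r ∧ (b ∨ c) ∷ [] }) tt
           (λ w → R w ∷ A w x ∷ A x w ∷ []) (λ w → antisym w x))) _

    outside-in-neighbour : ∀ {x y} → Sides x y → ∃ λ u → N u ≡ false × A u x ≡ true
    outside-in-neighbour {x} {y} s =
      let u , ¬N∧ux = count-positive (λ u → not (N u) ∧ A u x)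
                        (+-cancelʳ-≤ 1 1 (a x) (≤-trans (proj₂ (proj₂ (tight s))) (+-monoʳ-≤ (a x) (⟦⟧≤1 (A y x)))))
          ¬Nu , ux  = ∧-true (not (N u)) ¬N∧ux
      in u , trans (sym (Bool.not-involutive (N u))) (cong not ¬Nu) , ux

    -- The path x → w → u avoids the two big in-neighbours of u.
    no-x→R : ∀ {x w u} → A w u ≡ true → 2 ≤ bigIn u → A u x ≡ true → R w ≡ true → A x w ≡ true → ⊥
    no-x→R {x} {w} {u} wu 2≤b ux Rw xw with pick (λ z → A z u ∧ big z) [] (≤-trans (s≤s z≤n) 2≤b)
    ... | b₁ , bb₁ , _ with pick (λ z → A z u ∧ big z) (b₁ ∷ []) 2≤b
    ...   | b₂ , bb₂ , b₂≢b₁ ∷ [] =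
      no-1-path-2-high (path xw wu) (big⇒high bb₁) (big⇒high bb₂) (b₂≢b₁ ∘ sym)
        (x≢ bb₁ ∷ x≢ bb₂ ∷ [] , w≢ bb₁ ∷ w≢ bb₂ ∷ [])
      where
      x≢ : ∀ {z} → A z u ∧ big z ≡ true → x ≢ z
      x≢ eq refl = true≢false (proj₁ (∧-true (A x u) eq)) (proj₂ ori u x ux)
      w≢ : ∀ {z} → A z u ∧ big z ≡ true → w ≢ z
      w≢ eq refl = true≢false (proj₂ (∧-true (A w u) eq)) (trans (big≡¬R w) (cong not Rw))

    -- `w` and `x` are adjacent, and an in-neighbour `u` of `x` outside `N` excludes the direction
    -- `x → w`.
    R→x : ∀ {x y w} → Sides x y → R w ≡ true → A w x ≡ true
    R→x {x} {y} {w} s Rw =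
      let u , ¬Nu , ux = outside-in-neighbour s
          R→u , 2≤b    = outside-tight ¬Nu
      in Bool.¬-not λ ¬wx → no-x→R (R→u w Rw) 2≤b ux Rw (trans (cong (_∨ A x w) (sym ¬wx)) (R-adjacent s Rw))

    2≤bigIn : ∀ {x y} → Sides x y → 2 ≤ bigIn x
    2≤bigIn {x} s = ≤-trans (proj₂ (proj₂ (tight s))) (subst (λ c → a x + c ≤ bigIn x) (⟦A∧big⟧ s) (a+y≤bigIn s))

    split : Split A R
    split = complete , independent , regular
      where
      complete : (x y : Fin n) → R x ≡ true → R y ≡ false → A x y ≡ true
      complete x y Rx ¬Ry with ¬R-cases ¬Ry
      ... | inj₁ ¬Ny          = proj₁ (outside-tight ¬Ny) x Rx
      ... | inj₂ (inj₁ refl)  = R→x pq-sides Rx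
      ... | inj₂ (inj₂ refl)  = R→x (swap pq-sides) Rx
      R⇒∉pq : ∀ {x} → R x ≡ true → N x ≡ true × All (x ≢_) (p ∷ q ∷ [])
      R⇒∉pq {x} Rx with ∧-true (N x) Rx
      ... | Nx , ≠pq with ∧-true (not (x == p)) ≠pq
      ...   | x≠p , x≠q = Nx , not-==⇒≢ x≠p ∷ not-==⇒≢ x≠q ∷ []
      independent : (x y : Fin n) → R x ≡ true → R y ≡ true → A x y ≡ false
      independent x y Rx Ry = Bool.¬-not λ xy →
        no-1-path-2-high (path xy (proj₁ (R⇒∉pq Ry))) high-p high-q p≢q (proj₂ (R⇒∉pq Rx) , proj₂ (R⇒∉pq Ry))
      regular : (y : Fin n) → R y ≡ false → inDegIn A (λ u → not (R u)) y ≡ 2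
      regular y ¬Ry = trans
        (count-cong λ u → trans (cong (_∧ A u y) (sym (big≡¬R u))) (Bool.∧-comm (big u) (A u y)))
        (≤-antisym (bigIn≤2 y) (2≤b (¬R-cases ¬Ry)))
        where
        2≤b : N y ≡ false ⊎ y ≡ p ⊎ y ≡ q → 2 ≤ bigIn y
        2≤b (inj₁ ¬Ny)         = proj₂ (outside-tight ¬Ny)
        2≤b (inj₂ (inj₁ refl)) = 2≤bigIn pq-sides
        2≤b (inj₂ (inj₂ refl)) = 2≤bigIn (swap pq-sides)

argmax : (f : Fin (suc n) → ℕ) → ∃ λ v → ∀ u → f u ≤ f v
argmax {zero}  f = zero , λ { zero → ≤-refl }
argmax {suc n} f with argmax (f ∘ suc)
... | v , max with ≤-total (f zero) (f (suc v))
...   | inj₁ le = suc v , λ { zero → le ; (suc u) → max u }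
...   | inj₂ le = zero , λ { zero → ≤-refl ; (suc u) → ≤-trans (max u) le }

arcs≡sum-d : (A : Digraph n) → arcs A ≡ sumFin (InPaths.d A)
arcs≡sum-d A = trans (sum-cong λ i → count-sum (A i))
  (trans (sum-swap (λ i j → ⟦ A i j ⟧)) (sum-cong λ j → sym (count-sum (λ i → A i j))))

many-arcs⇒split : (A : Digraph n) → IsOriented A → Free A (S⃗ 3) → n ≥ 40 →
                  ((n + 2) * (n + 2)) / 4 ≤ arcs A → Σ (Fin n → Bool) (Split A)
many-arcs⇒split {zero}      A ori free ()
many-arcs⇒split {n@(suc _)} A ori free n≥40 many =
  let v , max                     = argmax (InPaths.d A)
      many′                       = subst (((n + 2) * (n + 2)) / 4 ≤_) (arcs≡sum-d A) many
      p , q , high-p , high-q , ≢ = MaximumInDegree.two-high A ori free n≥40 v max many′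
  in MaximumInDegree.TwoHigh.R A ori free n≥40 v max many′ p q high-p high-q ≢
   , MaximumInDegree.TwoHigh.split A ori free n≥40 v max many′ p q high-p high-q ≢

-- Split digraphs

count-not : (X : Fin n → Bool) → count X + count (λ i → not (X i)) ≡ n
count-not {zero}  X = refl
count-not {suc n} X with X zero
... | true  = cong suc (count-not (X ∘ suc))
... | false = trans (+-suc _ _) (cong suc (count-not (X ∘ suc)))

module _ (A : Digraph n) (ori : IsOriented A) (X : Fin n → Bool) (split : Split A X) where

  open InPaths A using (d)

  X-source : ∀ {x} → X x ≡ true → ∀ z → A z x ≡ false
  X-source {x} Xx z with X z in Xz
  ... | true  = proj₁ (proj₂ split) z x Xz Xx
  ... | false = proj₂ ori x z (proj₁ split x z Xx Xz)

  head∉X : ∀ {z w} → A z w ≡ true → X w ≡ false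
  head∉X {z} zw = Bool.¬-not λ Xw → true≢false zw (X-source Xw z)

  split-indegree : ∀ {y} → X y ≡ false → d y ≡ count X + 2
  split-indegree {y} ¬Xy = trans
    (≤-antisym
      (count-≤ 2 (λ { (x ∷ b ∷ []) → (x ⇒ b) , b ∷ [] , x ∷ not x ∧ b ∷ [] }) tt (λ z → X z ∷ A z y ∷ []) X⇒A)
      (count-≤ 2 (λ { (x ∷ b ∷ []) → (x ⇒ b) , x ∷ not x ∧ b ∷ [] , b ∷ [] }) tt (λ z → X z ∷ A z y ∷ []) X⇒A))
    (cong (count X +_) (proj₂ (proj₂ split) y ¬Xy))
    where
    X⇒A : ∀ z → (X z ⇒ A z y) ≡ true
    X⇒A z with X z in Xz
    ... | true  = proj₁ split z y Xz ¬Xy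
    ... | false = refl

  split-arcs : arcs A ≡ (count X + 2) * count (λ u → not (X u))
  split-arcs = trans (arcs≡sum-d A) (trans (sum-cong pointwise)
    (trans (sum-*ˡ (count X + 2) (λ u → ⟦ not (X u) ⟧)) (cong ((count X + 2) *_) (sym (count-sum (not ∘ X))))))
    where
    pointwise : ∀ u → d u ≡ (count X + 2) * ⟦ not (X u) ⟧
    pointwise u with X u in Xu
    ... | true  = trans (count-false (X-source Xu)) (sym (*-zeroʳ (count X + 2)))
    ... | false = trans (split-indegree Xu) (sym (*-identityʳ _))

  -- Vertices of `X` have no in-neighbours, so the three midpoints lie in `Y`, where the centre has
  -- only two in-neighbours.
  split-free : Free A (S⃗ 3)
  split-free (f , inj , z₁w₁ ∷ w₁v ∷ z₂w₂ ∷ w₂v ∷ z₃w₃ ∷ w₃v ∷ []) =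
    1+n≰n (subst (3 ≤_) (proj₂ (proj₂ split) v (head∉X w₁v)) three)
    where
    v w₁ w₂ w₃ : Fin n
    v  = f 0F
    w₁ = f 1F
    w₂ = f 2F
    w₃ = f 3F
    Q : Fin n → Bool
    Q u = not (X u) ∧ A u v
    three : 3 ≤ count Q
    three = subst (_≤ count Q)
      (cong₂ _+_ (count-single w₁) (cong₂ _+_ (count-single w₂) (count-single w₃)))
      (count-≤ 4 (λ { (e ∷ g ∷ h ∷ b ∷ []) → (e ⇒ b ∧ not g ∧ not h) ∧ (g ⇒ b ∧ not h) ∧ (h ⇒ b)
                    , e ∷ g ∷ h ∷ [] , b ∷ [] }) tt
         (λ u → u == w₁ ∷ u == w₂ ∷ u == w₃ ∷ Q u ∷ [])
         (λ u → ==-elim (λ u → Q u ∧ not (u == w₂) ∧ not (u == w₃)) w₁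
                  ((not-true (head∉X z₁w₁) & w₁v) & distinct (λ ()) & distinct (λ ())) u
              & ==-elim (λ u → Q u ∧ not (u == w₃)) w₂ ((not-true (head∉X z₂w₂) & w₂v) & distinct (λ ())) u
              & ==-elim Q w₃ (not-true (head∉X z₃w₃) & w₃v) u))
      where
      distinct : ∀ {i j} → i ≢ j → not (f i == f j) ≡ true
      distinct i≢j = ≢⇒not-== (i≢j ∘ inj)

-- An extremal digraph

-- Kinds 0–4 form a regular tournament on five vertices, the vertices of kind 5 are the remaining vertices
-- of Y, with in-neighbours of kinds 0 and 1, and kind 6 is X.
table : Fin 7 → Fin 7 → Bool
table i j = lookup (lookup rows i) j
  where
  o l : Bool
  o = false
  l = true
  rows : Vec (Vec Bool 7) 7
  rows = (o ∷ l ∷ l ∷ o ∷ o ∷ l ∷ o ∷ [])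
       ∷ (o ∷ o ∷ l ∷ l ∷ o ∷ l ∷ o ∷ [])
       ∷ (o ∷ o ∷ o ∷ l ∷ l ∷ o ∷ o ∷ [])
       ∷ (l ∷ o ∷ o ∷ o ∷ l ∷ o ∷ o ∷ [])
       ∷ (l ∷ l ∷ o ∷ o ∷ o ∷ o ∷ o ∷ [])
       ∷ (o ∷ o ∷ o ∷ o ∷ o ∷ o ∷ o ∷ [])
       ∷ (l ∷ l ∷ l ∷ l ∷ l ∷ l ∷ o ∷ [])
       ∷ []

module Construction {m : ℕ} (s : ℕ) (s≤m : s ≤ m) where

  outer : Bool → Fin 7
  outer x = if x then 6F else 5F

  kind : Fin (5 + m) → Fin 7
  kind 0F = 0F
  kind 1F = 1F
  kind 2F = 2F
  kind 3F = 3F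
  kind 4F = 4F
  kind (suc (suc (suc (suc (suc i))))) = outer (toℕ i <ᵇ s)

  D : Digraph (5 + m)
  D i j = table (kind i) (kind j)

  X : Fin (5 + m) → Bool
  X i = kind i == 6F

  D-oriented : IsOriented D
  D-oriented = (λ i → from-yes (all? λ a → table a a Bool.≟ false) (kind i))
             , (λ i j ij → Bool.not-injective (⇒-elim (table (kind i) (kind j)) (table-antisym (kind i) (kind j)) ij))
    where
    table-antisym : ∀ a b → (table a b ⇒ not (table b a)) ≡ true
    table-antisym = from-yes (all? λ a → all? λ b → (table a b ⇒ not (table b a)) Bool.≟ true)

  count-initial : ∀ m s → s ≤ m → count {m} (λ i → toℕ i <ᵇ s) ≡ s
  count-initial m       zero    s≤m       = count-false {m} λ _ → refl
  count-initial (suc m) (suc s) (s≤s s≤m) = cong suc (count-initial m s s≤m)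

  count-X : count X ≡ s
  count-X = trans (count-cong {m} λ i → outer-6F (toℕ i <ᵇ s)) (count-initial m s s≤m)
    where
    outer-6F : ∀ b → outer b == 6F ≡ b
    outer-6F true  = refl
    outer-6F false = refl

  D-split : Split D X
  D-split = (λ x y Xx ¬Xy → complete (kind x) (kind y) (Xx & not-true ¬Xy))
          , (λ x y Xx Xy → independent (kind x) (kind y) (Xx & Xy))
          -- The five tournament vertices are counted one by one; the remaining vertices send no
          -- arcs within `Y`.
          , (λ y ¬Xy → trans (cong (core-indegree (kind y)) (count-false {m} λ i → no-outer (kind y) (toℕ i <ᵇ s)))
                             (regular (kind y) ¬Xy))
    where
    complete : ∀ a b → (a == 6F ∧ not (b == 6F)) ≡ true → table a b ≡ true
    complete a b = ⇒-elim _ (from-yes (all? λ a → all? λ b → (a == 6F ∧ not (b == 6F) ⇒ table a b) Bool.≟ true) a b)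
    independent : ∀ a b → (a == 6F ∧ b == 6F) ≡ true → table a b ≡ false
    independent a b h with a ≟ 6F | b ≟ 6F
    independent a b h | yes refl | yes refl = refl
    core-indegree : Fin 7 → ℕ → ℕ
    core-indegree b c = ⟦ table 0F b ⟧ + (⟦ table 1F b ⟧ + (⟦ table 2F b ⟧
                        + (⟦ table 3F b ⟧ + (⟦ table 4F b ⟧ + c))))
    no-outer : ∀ b x → not (outer x == 6F) ∧ table (outer x) b ≡ false
    no-outer b true  = refl
    no-outer b false = from-yes (all? λ b → table 5F b Bool.≟ false) b
    regular : ∀ b → b == 6F ≡ false → core-indegree b 0 ≡ 2
    regular 0F _ = refl
    regular 1F _ = refl
    regular 2F _ = refl
    regular 3F _ = refl
    regular 4F _ = refl
    regular 5F _ = refl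
    regular 6F ()

extremal-digraph : n ≥ 40 → Σ (Digraph n) λ A → IsOriented A × Σ (Fin n → Bool) (ExtremalPartition A)
extremal-digraph n≥40 with m≤n⇒∃[o]m+o≡n (≤-trans (m≤n+m 7 33) n≥40)
... | m , refl = D , D-oriented , X , inj₁ count-X , D-split
  -- Here `n = 7 + m`: five tournament vertices and `2 + m` others, of which
  -- `⌊ n /2⌋ ∸ 1 = 2 + ⌈ m /2⌉` form `X`.
  where open Construction {2 + m} (⌊ 7 + m /2⌋ ∸ 1) (s≤s (s≤s (⌈n/2⌉≤n m)))

-- Arc counts of split digraphs and the theorem

extremal⇒free×maximal : (A : Digraph n) → IsOriented A → n ≥ 40 → Σ (Fin n → Bool) (ExtremalPartition A) →
                        Free A (S⃗ 3) × arcs A ≡ ((n + 2) * (n + 2)) / 4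
extremal⇒free×maximal {n} A ori n≥40 (X , half , split) = split-free A ori X split , (begin
  arcs A                                 ≡⟨ split-arcs A ori X split ⟩
  (x + 2) * y                            ≡⟨ balanced⇒maximal (x + 2) y (proj₁ balanced) (proj₂ balanced) ⟩
  ((x + 2 + y) * (x + 2 + y)) / 4         ≡⟨ cong (λ c → (c * c) / 4) (trans (eq x y) (cong (_+ 2) (count-not X))) ⟩
  ((n + 2) * (n + 2)) / 4                 ∎)
  where
  open ≡-Reasoning
  x y : ℕ
  x = count X
  y = count (λ i → not (X i))
  eq : ∀ x y → x + 2 + y ≡ x + y + 2
  eq = solve-∀
  balanced : x + 2 ≤ suc y × y ≤ suc (x + 2)
  balanced = half⇒balanced n x y (≤-trans (m≤n+m 2 38) n≥40) (count-not X) half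

-- The arc count `(|X| + 2) * |Y|` is a product with factor sum `n + 2`. Near-equality in the AM-GM
-- bound recovers the size of `X`, on which `Split` is silent.
split⇒≤×extremal : (A : Digraph n) → IsOriented A → (X : Fin n → Bool) → Split A X →
  arcs A ≤ ((n + 2) * (n + 2)) / 4 × (((n + 2) * (n + 2)) / 4 ≤ arcs A → ExtremalPartition A X)
split⇒≤×extremal {n} A ori X split =
    subst₂ _≤_ (sym arcs≡) M≡ (am-gm (x + 2) y)
  , λ M≤ → let M≤xy = subst₂ _≤_ (sym M≡) arcs≡ M≤ in
      subst (λ m → x ≡ ⌊ m /2⌋ ∸ 1 ⊎ x ≡ ⌈ m /2⌉ ∸ 1) (count-not X)
        (balanced⇒half x y (maximal⇒balanced (x + 2) y M≤xy)
          (maximal⇒balanced y (x + 2) (subst₂ (λ s t → (s * s) / 4 ≤ t) (+-comm (x + 2) y) (*-comm (x + 2) y) M≤xy)))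
      , split
  where
  x y : ℕ
  x = count X
  y = count (λ i → not (X i))
  arcs≡ : arcs A ≡ (x + 2) * y
  arcs≡ = split-arcs A ori X split
  eq : ∀ x y → x + 2 + y ≡ x + y + 2
  eq = solve-∀
  M≡ : ((x + 2 + y) * (x + 2 + y)) / 4 ≡ ((n + 2) * (n + 2)) / 4
  M≡ = cong (λ c → (c * c) / 4) (trans (eq x y) (cong (_+ 2) (count-not X)))

theorem1p2 : (n : ℕ) → n ≥ 40 →
    IsExOri n (S⃗ 3) (((n + 2) * (n + 2)) / 4)
    × ((A : Digraph n) → IsOriented A →
    ((Free A (S⃗ 3) × arcs A ≡ ((n + 2) * (n + 2)) / 4)
    ⇔ Σ (Fin n → Bool) (λ X → ExtremalPartition A X)))
theorem1p2 n n≥40 = (upper , attained) , λ A ori → mk⇔ (forward A ori) (extremal⇒free×maximal A ori n≥40)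
  where
  M : ℕ
  M = ((n + 2) * (n + 2)) / 4
  upper : (A : Digraph n) → IsOriented A → Free A (S⃗ 3) → arcs A ≤ M
  -- A free digraph with at least `M` arcs is split, and a split digraph has at most `M` arcs.
  upper A ori free = [ (λ le → le) , (λ M≤ → let X , split = many-arcs⇒split A ori free n≥40 M≤
                                             in proj₁ (split⇒≤×extremal A ori X split)) ]′ (≤-total (arcs A) M)
  attained : Σ (Digraph n) (λ A → IsOriented A × Free A (S⃗ 3) × arcs A ≡ M)
  attained = let A , ori , extremal = extremal-digraph n≥40
             in A , ori , extremal⇒free×maximal A ori n≥40 extremal
  forward : (A : Digraph n) → IsOriented A → Free A (S⃗ 3) × arcs A ≡ M → Σ (Fin n → Bool) (ExtremalPartition A)
  forward A ori (free , eq) =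
    let X , split = many-arcs⇒split A ori free n≥40 (≤-reflexive (sym eq))
    in X , proj₂ (split⇒≤×extremal A ori X split) (≤-reflexive (sym eq))
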